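{- There exist constants $c>0$ and $C>0$ such that for every integer $n\ge 2$ there exist a positive integer $k\le C\, n^{2/3}(\log n)^{1/2}$ and a randomized $\mathrm{MAJ}_k\circ\mathrm{MAJ}_k$ circuit $\mathcal{C}$ on the variables $x_1,\dots,x_n$ such that for every input $A\in\{0,1\}^n$ the probability that $\mathcal{C}(A)\ne \mathrm{MAJ}_n(A)$ is at most $1/\mathrm{poly}(n)$, i.e. at most $n^{ -c}$.
   Context: $\mathrm{MAJ}_n(x_1,\dots,x_n)=1$ if $\sum_{i=1}^n x_i\ge n/2$, and $0$ otherwise. For a positive integer $k$, a $\mathrm{MAJ}_k\circ\mathrm{MAJ}_k$ circuit on $x_1,\dots,x_n$ is a depth two formula with a single top gate whose inputs are bottom-level gates, the inputs of each bottom-level gate being variables among $x_1,\dots,x_n$. Every gate (top and bottom) is a threshold gate: with inputs $z_1,\dots,z_r$ it outputs $1$ if $\sum_i c_i z_i\ge t$ and $0$ otherwise, where the weights $c_i$ are positive integers with $\sum_i c_i\le k$ and $t$ is an arbitrary integer threshold (weights and thresholds may differ from gate to gate). A weight $c_i$ can equivalently be seen as repeating the input $z_i$ $c_i$ times. A randomized $\mathrm{MAJ}_k\circ\mathrm{MAJ}_k$ circuit is a probability distribution on (deterministic) $\mathrm{MAJ}_k\circ\mathrm{MAJ}_k$ circuits; the error probability on a fixed input $A$ is the probability, over a circuit drawn from this distribution, that the circuit outputs the wrong value on $A$. -}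

module Defs where

open import Data.Bool using (Bool; if_then_else_; _xor_)
open import Data.Fin using (Fin)
open import Data.Integer as ℤ using (ℤ; +_; ∣_∣)
open import Data.List using (List; map; foldr)
open import Data.List.Relation.Unary.All using (All)
open import Data.Nat using (ℕ; _*_; _≤_; _<_; _≤?_)
import Data.Nat as ℕ
open import Data.Nat.ListAction using (sum)
open import Data.Product using (_×_; _,_; proj₁)
open import Data.Rational as ℚ using (ℚ; 0ℚ; 1ℚ; ↥_; ↧ₙ_)
open import Data.Vec as Vec using (Vec; lookup)
open import Relation.Binary.PropositionalEquality using (_≡_)
open import Relation.Nullary using (does)

import Algebra.Definitions.RawSemiring ℚ.+-*-rawSemiring as ℚSemiring

bit : Bool → ℕ
bit b = if b then 1 else 0

MAJ : ∀ {n} → Vec Bool n → Bool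
MAJ {n} x = does (n ≤? 2 * Vec.sum (Vec.map bit x))

-- A threshold gate of total weight at most k whose inputs are drawn from I,
-- each given together with its weight.
record Gate (k : ℕ) (I : Set) : Set where
  field
    inputs    : List (ℕ × I)
    positive  : All (λ cz → 0 < proj₁ cz) inputs
    bounded   : sum (map proj₁ inputs) ≤ k
    threshold : ℤ

evalGate : ∀ {k I} → Gate k I → (I → Bool) → Bool
evalGate g z =
  does (threshold ℤ.≤? + sum (map (λ (c , i) → c * bit (z i)) inputs))
  where open Gate g

-- MAJ_k ∘ MAJ_k circuits on n variables.
Circuit : ℕ → ℕ → Set
Circuit k n = Gate k (Gate k (Fin n))

eval : ∀ {k n} → Circuit k n → Vec Bool n → Bool
eval C x = evalGate C (λ g → evalGate g (lookup x))

sumℚ : List ℚ → ℚ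
sumℚ = foldr ℚ._+_ 0ℚ

-- Finitely supported probability distributions with rational probabilities.
record Distribution (X : Set) : Set where
  field
    outcomes    : List (ℚ × X)
    nonNegative : All (λ px → 0ℚ ℚ.≤ proj₁ px) outcomes
    total       : sumℚ (map proj₁ outcomes) ≡ 1ℚ

Pr : ∀ {X} → Distribution X → (X → Bool) → ℚ
Pr D E = sumℚ (map (λ (p , x) → if E x then p else 0ℚ) outcomes)
  where open Distribution D

RandomizedCircuit : ℕ → ℕ → Set
RandomizedCircuit k n = Distribution (Circuit k n)

error : ∀ {k n} → RandomizedCircuit k n → Vec Bool n → ℚ
error 𝒞 A = Pr 𝒞 (λ C → eval C A xor MAJ A)

infixr 8 _^_
_^_ : ℚ → ℕ → ℚ
_^_ = ℚSemiring._^_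

fromℕ : ℕ → ℚ
fromℕ m = (+ m) ℚ./ 1

-- x ≤ n ^ (- c) for x, c ≥ 0 and n ≥ 1: with c = p / q in lowest terms this
-- is x ^ q * n ^ p ≤ 1.
_≤_^-_ : ℚ → ℕ → ℚ → Set
x ≤ n ^- c = x ^ ↧ₙ c ℚ.* fromℕ n ^ ∣ ↥ c ∣ ℚ.≤ 1ℚ

-- log₂ n ≤ u for n ≥ 1: the logarithm is nonnegative, so u must be, and with
-- u = p / q the inequality is n ^ q ≤ 2 ^ p.
log₂_≤_ : ℕ → ℚ → Set
log₂ n ≤ u = 0ℚ ℚ.≤ u × n ℕ.^ ↧ₙ u ≤ 2 ℕ.^ ∣ ↥ u ∣

-- k ≤ C * n ^ (2/3) * (log₂ n) ^ (1/2) for C ≥ 0 and n ≥ 1, raised to the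
-- sixth power.  The real number log₂ n is the infimum of its rational upper
-- bounds, so comparing with all of these is the same as comparing with it.
_≤_·n^⅔·√log_ : ℕ → ℚ → ℕ → Set
k ≤ C ·n^⅔·√log n =
  ∀ u → log₂ n ≤ u →
  fromℕ k ^ 6 ℚ.≤ C ^ 6 ℚ.* fromℕ n ^ 4 ℚ.* u ^ 3

{-# OPTIONS --safe #-}
-- Arrange the inputs, padded with zeros, as s² rows by s columns with s³ ≥ n, and rotate
-- each row by an independent uniform shift.  The columns partition the inputs into s blocks,
-- and each block sum is a sum of independent bits with mean W/s, where W is the weight of
-- the input; a Chernoff bound keeps all block sums within T = O(s √log n) of this mean,
-- except with probability 1/n.  A block sum that lies in a window of 4T consecutive values
-- is a constant plus the sum of 4T threshold gates on the block, so the top gate recovers W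
-- from O(s T) = O(n^(2/3) √log n) gates of fan-in s².
module Submission where

open import Defs renaming (_^_ to _^ℚ_)
open import Algebra.Bundles using (CommutativeMonoid)
open import Data.Bool using (Bool; true; false; if_then_else_; _xor_)
open import Data.Bool.Properties using (xor-same)
open import Data.Fin using (Fin; zero; suc)
open import Data.Integer as ℤ using (-[1+_]; _⊖_)
import Data.Integer.Properties as ℤ
open import Data.List using (List; []; _∷_; _++_; map; concat; applyUpTo; length)
open import Data.List.Properties using (map-∘; map-++; length-++; length-map; length-applyUpTo)
import Data.List.Relation.Unary.All as All
import Data.List.Relation.Unary.All.Properties as All
open import Data.Nat
open import Data.Nat.Coprimality as Coprimality using (1-coprimeTo)
open import Data.Nat.DivMod
open import Data.Nat.ListAction using (sum)
open import Data.Nat.ListAction.Properties using (sum-++)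
open import Data.Nat.Properties
open import Data.Nat.Tactic.RingSolver using (solve-∀)
open import Data.Product using (_×_; _,_; proj₁; ∃-syntax; Σ-syntax)
open import Data.Rational as ℚ using (ℚ; 0ℚ; 1ℚ; mkℚ; toℚᵘ) renaming (_<_ to _<ℚ_)
import Data.Rational.Properties as ℚ
open import Data.Rational.Unnormalised as ℚᵘ using (mkℚᵘ; *≡*)
import Data.Rational.Unnormalised.Properties as ℚᵘ
open import Data.Sum using (_⊎_; inj₁; inj₂)
open import Data.Vec as Vec using (Vec; []; _∷_; lookup)
open import Function using (_∘_; _$_; it; mk⇔; _⇔_; Equivalence)
open import Relation.Binary.PropositionalEquality
open import Relation.Nullary using (Dec; does; yes; no; ¬_)
open import Relation.Nullary.Decidable using (does-⇔; dec-true)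

import Algebra.Properties.CommutativeSemigroup *-commutativeSemigroup as *
import Algebra.Properties.CommutativeSemigroup +-commutativeSemigroup as +
import Algebra.Properties.CommutativeSemigroup
  (CommutativeMonoid.commutativeSemigroup ℚ.*-1-commutativeMonoid) as ℚ*

-- A column meets every row in exactly one cell, so its bits are independent and an exponential
-- moment, summed over all shifts, factors exactly over the rows; sampling a block without
-- replacement would lack this. To stay within natural numbers the moment has base `1 + 1/d` in
-- place of an exponential. Its mean is at most `(1 + 1/d)^((d + 1) W / (m d))`, whose exponent
-- exceeds `W / m` by `W / (m d) ≤ p / d`. The hypothesis `p + d * Q ≤ d * T` says that `T` pays for
-- this excess and leaves `Q`. With `t` of order √log n and `s = d t`, the excess is `d t²`, and
-- `Q = 9 d t²` gives `(1 + 1/d)^Q ≥ 2^(9 t²) ≥ n⁹`. Making `s` a multiple of `t` lets the Chernoff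
-- parameter `s / t` be the integer `d`.

-- Finite sums over initial segments and over lists.

∑ : ℕ → (ℕ → ℕ) → ℕ
∑ n f = sum (applyUpTo f n)

∑-cong : ∀ n {f g : ℕ → ℕ} → (∀ i → f i ≡ g i) → ∑ n f ≡ ∑ n g
∑-cong zero    f≗g = refl
∑-cong (suc n) f≗g = cong₂ _+_ (f≗g 0) (∑-cong n (f≗g ∘ suc))

∑-mono : ∀ n {f g : ℕ → ℕ} → (∀ i → i < n → f i ≤ g i) → ∑ n f ≤ ∑ n g
∑-mono zero    f≤g = z≤n
∑-mono (suc n) f≤g = +-mono-≤ (f≤g 0 z<s) (∑-mono n λ i i<n → f≤g (suc i) (s<s i<n))

∑-+ : ∀ n (f g : ℕ → ℕ) → ∑ n (λ i → f i + g i) ≡ ∑ n f + ∑ n g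
∑-+ zero    f g = refl
∑-+ (suc n) f g = begin
  f 0 + g 0 + ∑ n (λ i → f (suc i) + g (suc i))   ≡⟨ cong (f 0 + g 0 +_) (∑-+ n (f ∘ suc) (g ∘ suc)) ⟩
  f 0 + g 0 + (∑ n (f ∘ suc) + ∑ n (g ∘ suc))     ≡⟨ +.interchange (f 0) (g 0) _ _ ⟩
  f 0 + ∑ n (f ∘ suc) + (g 0 + ∑ n (g ∘ suc))     ∎
  where open ≡-Reasoning

∑-const : ∀ n c → ∑ n (λ _ → c) ≡ n * c
∑-const zero    c = refl
∑-const (suc n) c = cong (c +_) (∑-const n c)

∑-distribʳ-* : ∀ n (f : ℕ → ℕ) c → ∑ n (λ i → f i * c) ≡ ∑ n f * c
∑-distribʳ-* zero    f c = refl
∑-distribʳ-* (suc n) f c =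
  trans (cong (f 0 * c +_) (∑-distribʳ-* n (f ∘ suc) c)) (sym (*-distribʳ-+ c (f 0) _))

∑-snoc : ∀ n f → ∑ (suc n) f ≡ ∑ n f + f n
∑-snoc zero    f = +-identityʳ (f 0)
∑-snoc (suc n) f = trans (cong (f 0 +_) (∑-snoc n (f ∘ suc))) (sym (+-assoc (f 0) _ _))

∑-split : ∀ m n f → ∑ (m + n) f ≡ ∑ m f + ∑ n (λ i → f (m + i))
∑-split zero    n f = refl
∑-split (suc m) n f = trans (cong (f 0 +_) (∑-split m n (f ∘ suc))) (sym (+-assoc (f 0) _ _))

∑∈ : ∀ {A : Set} → List A → (A → ℕ) → ℕ
∑∈ xs f = sum (map f xs)

module _ {A : Set} where

  ∑∈-++ : ∀ (xs ys : List A) f → ∑∈ (xs ++ ys) f ≡ ∑∈ xs f + ∑∈ ys f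
  ∑∈-++ xs ys f = trans (cong sum (map-++ f xs ys)) (sum-++ (map f xs) (map f ys))

  ∑∈-mono : ∀ (xs : List A) {f g} → (∀ x → f x ≤ g x) → ∑∈ xs f ≤ ∑∈ xs g
  ∑∈-mono []       f≤g = z≤n
  ∑∈-mono (x ∷ xs) f≤g = +-mono-≤ (f≤g x) (∑∈-mono xs f≤g)

  ∑∈-cong : ∀ (xs : List A) {f g} → (∀ x → f x ≡ g x) → ∑∈ xs f ≡ ∑∈ xs g
  ∑∈-cong []       f≗g = refl
  ∑∈-cong (x ∷ xs) f≗g = cong₂ _+_ (f≗g x) (∑∈-cong xs f≗g)

  ∑∈-distribˡ-* : ∀ (xs : List A) f c → ∑∈ xs (λ x → c * f x) ≡ c * ∑∈ xs f
  ∑∈-distribˡ-* []       f c = sym (*-zeroʳ c)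
  ∑∈-distribˡ-* (x ∷ xs) f c =
    trans (cong (c * f x +_) (∑∈-distribˡ-* xs f c)) (sym (*-distribˡ-+ c (f x) _))

  ∑∈-distribʳ-* : ∀ (xs : List A) f c → ∑∈ xs (λ x → f x * c) ≡ ∑∈ xs f * c
  ∑∈-distribʳ-* []       f c = refl
  ∑∈-distribʳ-* (x ∷ xs) f c =
    trans (cong (f x * c +_) (∑∈-distribʳ-* xs f c)) (sym (*-distribʳ-+ c (f x) _))

  ∑∈-+ : ∀ (xs : List A) (f g : A → ℕ) → ∑∈ xs (λ x → f x + g x) ≡ ∑∈ xs f + ∑∈ xs g
  ∑∈-+ []       f g = refl
  ∑∈-+ (x ∷ xs) f g = trans (cong (f x + g x +_) (∑∈-+ xs f g)) (+.interchange (f x) (g x) _ _)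

  ∑∈-∑-swap : ∀ (xs : List A) n (f : A → ℕ → ℕ) →
              ∑∈ xs (λ x → ∑ n (f x)) ≡ ∑ n (λ i → ∑∈ xs (λ x → f x i))
  ∑∈-∑-swap []       n f = sym (trans (∑-const n 0) (*-zeroʳ n))
  ∑∈-∑-swap (x ∷ xs) n f = trans (cong (∑ n (f x) +_) (∑∈-∑-swap xs n f)) (sym (∑-+ n (f x) _))

  ∑∈-map : ∀ {B : Set} (g : B → A) xs f → ∑∈ (map g xs) f ≡ ∑∈ xs (f ∘ g)
  ∑∈-map g xs f = cong sum (sym (map-∘ xs))

  ∑∈-concat-applyUpTo : ∀ n (g : ℕ → List A) f →
                        ∑∈ (concat (applyUpTo g n)) f ≡ ∑ n (λ i → ∑∈ (g i) f)
  ∑∈-concat-applyUpTo zero    g f = refl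
  ∑∈-concat-applyUpTo (suc n) g f =
    trans (∑∈-++ (g 0) _ f) (cong (∑∈ (g 0) f +_) (∑∈-concat-applyUpTo n (g ∘ suc) f))

-- One more unit of shift moves the first term to the end: with `g 0` put in front, the shifted sum
-- is `∑ (suc m) g`, whose last term `g m` equals `g 0` modulo `m`.
∑-rotate : ∀ m .{{_ : NonZero m}} f c → ∑ m (λ i → f ((i + c) % m)) ≡ ∑ m f
∑-rotate m f zero = go m f λ i i<m → trans (cong (_% m) (+-identityʳ i)) (m<n⇒m%n≡m i<m)
  where
  -- `∑-cong` asks for equality at every index, but `i % m ≡ i` needs `i < m`; two uses of `∑-mono`
  -- replace it.
  go : ∀ n {r : ℕ → ℕ} (f : ℕ → ℕ) → (∀ i → i < n → r i ≡ i) → ∑ n (f ∘ r) ≡ ∑ n f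
  go n f eq = ≤-antisym (∑-mono n λ i i<n → ≤-reflexive (cong f (eq i i<n)))
                        (∑-mono n λ i i<n → ≤-reflexive (cong f (sym (eq i i<n))))
∑-rotate m f (suc c) = +-cancelˡ-≡ (g 0) _ _ $ begin
  g 0 + ∑ m (λ i → f ((i + suc c) % m))  ≡⟨ cong (g 0 +_) (∑-cong m λ i → cong (f ∘ (_% m)) (+-suc i c)) ⟩
  ∑ (suc m) g                            ≡⟨ ∑-snoc m g ⟩
  ∑ m g + g m                            ≡⟨ cong₂ _+_ (∑-rotate m f c) (cong f (trans (cong (_% m) (+-comm m c)) ([m+n]%n≡m%n c m))) ⟩
  ∑ m f + g 0                            ≡⟨ +-comm _ (g 0) ⟩
  g 0 + ∑ m f                            ∎
  where
  open ≡-Reasoning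
  g : ℕ → ℕ
  g i = f ((i + c) % m)

-- Random row shifts, column sums and their exponential moments.

shifts : ∀ p (m : ℕ) → List (Vec ℕ p)
shifts zero    m = [] ∷ []
shifts (suc p) m = concat (applyUpTo (λ c → map (c ∷_) (shifts p m)) m)

∑∈-shifts-suc : ∀ p m f → ∑∈ (shifts (suc p) m) f ≡ ∑ m (λ c → ∑∈ (shifts p m) (λ σ → f (c ∷ σ)))
∑∈-shifts-suc p m f =
  trans (∑∈-concat-applyUpTo m _ f) (∑-cong m λ c → ∑∈-map (c ∷_) (shifts p m) f)

∑∈-shifts-1 : ∀ p m → ∑∈ (shifts p m) (λ _ → 1) ≡ m ^ p
∑∈-shifts-1 zero    m = refl
∑∈-shifts-1 (suc p) m =
  trans (∑∈-shifts-suc p m _) (trans (∑-cong m λ _ → ∑∈-shifts-1 p m) (∑-const m (m ^ p)))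

module _ (m : ℕ) .{{_ : NonZero m}} where

  -- The grid is stored in row-major order: the first row is `f` on the indices below `m`, and the
  -- remaining rows are `f` advanced by `m`. `weight`, `totalWeight` and `block` recurse in the same
  -- way.
  column : ∀ {p} → (ℕ → ℕ) → Vec ℕ p → ℕ → ℕ
  column f []      j = 0
  column f (c ∷ σ) j = f ((j + c) % m) + column (λ v → f (m + v)) σ j

  column-total : ∀ {p} f (σ : Vec ℕ p) → ∑ m (column f σ) ≡ ∑ (p * m) f
  column-total         f []      = trans (∑-const m 0) (*-zeroʳ m)
  column-total {suc p} f (c ∷ σ) = begin
    ∑ m (λ j → f ((j + c) % m) + column _ σ j)                      ≡⟨ ∑-+ m _ (column _ σ) ⟩
    ∑ m (λ j → f ((j + c) % m)) + ∑ m (column (λ v → f (m + v)) σ)  ≡⟨ cong₂ _+_ (∑-rotate m f c) (column-total _ σ) ⟩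
    ∑ m f + ∑ (p * m) (λ v → f (m + v))                             ≡⟨ ∑-split m (p * m) f ⟨
    ∑ (m + p * m) f                                                 ∎
    where open ≡-Reasoning

  -- Flipping all bits turns a small column sum into a large one, which reduces the lower tail to
  -- the upper one.
  column-complement : ∀ {p} f (σ : Vec ℕ p) j → (∀ v → f v ≤ 1) →
                      column f σ j + column (λ v → 1 ∸ f v) σ j ≡ p
  column-complement f []      j f≤1 = refl
  column-complement f (c ∷ σ) j f≤1 =
    trans (+.interchange (f _) _ _ _)
          (cong₂ _+_ (m+[n∸m]≡n (f≤1 _)) (column-complement _ σ j (f≤1 ∘ (m +_))))

  module _ (d : ℕ) where

    -- The exponential moment (1 + 1/d)^(column f σ j), scaled by dᵖ.
    weight : ∀ {p} → (ℕ → ℕ) → ℕ → Vec ℕ p → ℕ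
    weight f j []      = 1
    weight f j (c ∷ σ) = (d + f ((j + c) % m)) * weight (λ v → f (m + v)) j σ

    totalWeight : ℕ → (ℕ → ℕ) → ℕ
    totalWeight zero    f = 1
    totalWeight (suc p) f = (m * d + ∑ m f) * totalWeight p (λ v → f (m + v))

    -- As `c` runs over the shifts, `(j + c) % m` visits each cell of the row once, so a row
    -- contributes `m * d + ∑ m f` whatever `j` is; independence of the rows gives the product.
    ∑∈-weight : ∀ p f j → ∑∈ (shifts p m) (weight f j) ≡ totalWeight p f
    ∑∈-weight zero    f j = refl
    ∑∈-weight (suc p) f j = begin
      ∑∈ (shifts (suc p) m) (weight f j)
        ≡⟨ ∑∈-shifts-suc p m _ ⟩
      ∑ m (λ c → ∑∈ (shifts p m) (λ σ → (d + f ((j + c) % m)) * weight _ j σ))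
        ≡⟨ ∑-cong m (λ c → trans (∑∈-distribˡ-* (shifts p m) (weight (λ v → f (m + v)) j) (d + f ((j + c) % m))) (cong ((d + f ((j + c) % m)) *_) (∑∈-weight p (λ v → f (m + v)) j))) ⟩
      ∑ m (λ c → (d + f ((j + c) % m)) * totalWeight p (λ v → f (m + v)))
        ≡⟨ ∑-distribʳ-* m _ (totalWeight p (λ v → f (m + v))) ⟩
      ∑ m (λ c → d + f ((j + c) % m)) * totalWeight p (λ v → f (m + v))
        ≡⟨ cong (_* totalWeight p (λ v → f (m + v))) (trans (∑-+ m (λ _ → d) _) (cong₂ _+_ (∑-const m d) (trans (∑-cong m λ c → cong (f ∘ (_% m)) (+-comm j c)) (∑-rotate m f j)))) ⟩
      totalWeight (suc p) f ∎
      where open ≡-Reasoning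

    -- For a bit `b`, `d + b` equals `d (1 + 1/d)^b`; this is where `f` being 0/1-valued enters. The
    -- powers of `d` clear the denominators.
    weight-column : ∀ {p} f j (σ : Vec ℕ p) → (∀ v → f v ≤ 1) →
                    weight f j σ * d ^ column f σ j ≡ suc d ^ column f σ j * d ^ p
    weight-column f j []      f≤1 = refl
    weight-column {suc p} f j (c ∷ σ) f≤1 with f ((j + c) % m) | f≤1 ((j + c) % m) | weight-column (λ v → f (m + v)) j σ (f≤1 ∘ (m +_))
    ... | 0 | _ | ih = begin
      (d + 0) * w * d ^ s         ≡⟨ cong (λ x → x * w * d ^ s) (+-identityʳ d) ⟩
      d * w * d ^ s               ≡⟨ *-assoc d w _ ⟩
      d * (w * d ^ s)             ≡⟨ cong (d *_) ih ⟩
      d * (suc d ^ s * d ^ p)     ≡⟨ *.x∙yz≈y∙xz d (suc d ^ s) (d ^ p) ⟩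
      suc d ^ s * (d * d ^ p)     ∎
      where
      open ≡-Reasoning
      w = weight (λ v → f (m + v)) j σ
      s = column (λ v → f (m + v)) σ j
    ... | 1 | _ | ih = begin
      (d + 1) * w * (d * d ^ s)           ≡⟨ lemma d w (d ^ s) ⟩
      suc d * d * (w * d ^ s)             ≡⟨ cong (suc d * d *_) ih ⟩
      suc d * d * (suc d ^ s * d ^ p)     ≡⟨ *.interchange (suc d) d (suc d ^ s) (d ^ p) ⟩
      suc d * suc d ^ s * (d * d ^ p)     ∎
      where
      open ≡-Reasoning
      w = weight (λ v → f (m + v)) j σ
      s = column (λ v → f (m + v)) σ j
      lemma : ∀ d w x → (d + 1) * w * (d * x) ≡ suc d * d * (w * x)
      lemma = solve-∀
    ... | suc (suc _) | s≤s () | _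

-- Inequalities between powers that stand in for `1 + x ≤ exp x`.

^-distribʳ-* : ∀ k m n → (m * n) ^ k ≡ m ^ k * n ^ k
^-distribʳ-* zero    m n = refl
^-distribʳ-* (suc k) m n = trans (cong (m * n *_) (^-distribʳ-* k m n)) (*.interchange m n (m ^ k) (n ^ k))

^-cancelˡ-≤ : ∀ k .{{_ : NonZero k}} {m n} → m ^ k ≤ n ^ k → m ≤ n
^-cancelˡ-≤ k m^k≤n^k = ≮⇒≥ λ n<m → <⇒≱ (^-monoˡ-< k n<m) m^k≤n^k

-- 1 + a/M ≤ (1 + 1/M)ᵃ
bernoulli : ∀ M a → (M + a) * M ^ a ≤ M * suc M ^ a
bernoulli M zero    = ≤-reflexive (cong (_* 1) (+-identityʳ M))
bernoulli M (suc a) = begin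
  (M + suc a) * (M * M ^ a)             ≤⟨ m≤m+n _ _ ⟩
  (M + suc a) * (M * M ^ a) + a * M ^ a ≡⟨ lemma₁ M a (M ^ a) ⟩
  suc M * ((M + a) * M ^ a)             ≤⟨ *-monoʳ-≤ (suc M) (bernoulli M a) ⟩
  suc M * (M * suc M ^ a)               ≡⟨ *.x∙yz≈y∙xz (suc M) M (suc M ^ a) ⟩
  M * (suc M * suc M ^ a)               ∎
  where
  open ≤-Reasoning
  lemma₁ : ∀ M a x → (M + suc a) * (M * x) + a * x ≡ suc M * ((M + a) * x)
  lemma₁ = solve-∀

-- 1 ≤ (1 - 1/(x + 1))ᵏ + k/(x + 1)
bernoulli⁻ : ∀ x k → suc x ^ k * suc x ≤ x ^ k * suc x + k * suc x ^ k
bernoulli⁻ x zero    = ≤-reflexive (sym (+-identityʳ _))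
bernoulli⁻ x (suc k) = begin
  y * y ^ k * y                                   ≡⟨ lemma₁ y (y ^ k) ⟩
  y * (y ^ k * y)                                 ≤⟨ *-monoʳ-≤ y (bernoulli⁻ x k) ⟩
  y * (x ^ k * y + k * y ^ k)                     ≡⟨ lemma₂ x k (x ^ k) (y ^ k) ⟩
  x * x ^ k * y + (y * x ^ k + k * (y * y ^ k))   ≤⟨ +-monoʳ-≤ (x * x ^ k * y) (+-monoˡ-≤ (k * (y * y ^ k)) (*-monoʳ-≤ y (^-monoˡ-≤ k (n≤1+n x)))) ⟩
  x * x ^ k * y + (y * y ^ k + k * (y * y ^ k))   ∎
  where
  open ≤-Reasoning
  y = suc x
  lemma₁ : ∀ y z → y * z * y ≡ y * (z * y)
  lemma₁ = solve-∀
  lemma₂ : ∀ x k u v → suc x * (u * suc x + k * v) ≡ x * u * suc x + (suc x * u + k * (suc x * v))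
  lemma₂ = solve-∀

-- (1 + 1/M)ᴹ ≤ e ≤ (1 + 1/d)ᵈ⁺¹: for N = M (d + 1), Bernoulli bounds the left side
-- by (1 + 1/N)ᴺ and the inverse of the right side by (1 - 1/N)ᴺ.
euler-bounds : ∀ M .{{_ : NonZero M}} d → suc M ^ M * d ^ suc d ≤ M ^ M * suc d ^ suc d
euler-bounds M@(suc _) d = *-cancelʳ-≤ _ _ (N ^ N * N ^ N) {{m*n≢0 (N ^ N) (N ^ N) {{m^n≢0 N N}} {{m^n≢0 N N}}}} $ begin
  suc M ^ M * d ^ e * (N ^ N * N ^ N)           ≡⟨ *.interchange (suc M ^ M) (d ^ e) (N ^ N) (N ^ N) ⟩
  suc M ^ M * N ^ N * (d ^ e * N ^ N)           ≤⟨ *-mono-≤ upper lower ⟩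
  M ^ M * suc N ^ N * (e ^ e * x ^ N)           ≡⟨ *.interchange (M ^ M) (suc N ^ N) (e ^ e) (x ^ N) ⟩
  M ^ M * e ^ e * (suc N ^ N * x ^ N)           ≡⟨ cong (M ^ M * e ^ e *_) (^-distribʳ-* N (suc N) x) ⟨
  -- The product `(N + 1)(N - 1)` is one less than `N²`, so the two estimates nearly cancel, in the
  -- right direction.
  M ^ M * e ^ e * (suc N * x) ^ N               ≤⟨ *-monoʳ-≤ (M ^ M * e ^ e) (^-monoˡ-≤ N (≤-trans (n≤1+n _) (≤-reflexive (lemma x)))) ⟩
  M ^ M * e ^ e * (N * N) ^ N                   ≡⟨ cong (M ^ M * e ^ e *_) (^-distribʳ-* N N N) ⟩
  M ^ M * e ^ e * (N ^ N * N ^ N)               ∎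
  where
  open ≤-Reasoning
  e = suc d
  x = pred (M * e)
  N = suc x
  N≡ : N ≡ M * e
  N≡ = suc-pred (M * e)
  lemma : ∀ x → suc (suc (suc x) * x) ≡ suc x * suc x
  lemma = solve-∀
  upper : suc M ^ M * N ^ N ≤ M ^ M * suc N ^ N
  upper = begin
    suc M ^ M * N ^ N           ≡⟨ cong (λ k → suc M ^ M * N ^ k) (trans N≡ (*-comm M e)) ⟩
    suc M ^ M * N ^ (e * M)     ≡⟨ cong (suc M ^ M *_) (^-*-assoc N e M) ⟨
    suc M ^ M * (N ^ e) ^ M     ≡⟨ ^-distribʳ-* M (suc M) (N ^ e) ⟨
    (suc M * N ^ e) ^ M         ≤⟨ ^-monoˡ-≤ M (*-cancelˡ-≤ e step) ⟩
    (M * suc N ^ e) ^ M         ≡⟨ ^-distribʳ-* M M (suc N ^ e) ⟩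
    M ^ M * (suc N ^ e) ^ M     ≡⟨ cong (M ^ M *_) (^-*-assoc (suc N) e M) ⟩
    M ^ M * suc N ^ (e * M)     ≡⟨ cong (λ k → M ^ M * suc N ^ k) (trans N≡ (*-comm M e)) ⟨
    M ^ M * suc N ^ N           ∎
    where
    step : e * (suc M * N ^ e) ≤ e * (M * suc N ^ e)
    step = begin
      e * (suc M * N ^ e)   ≡⟨ *-assoc e (suc M) (N ^ e) ⟨
      e * suc M * N ^ e     ≡⟨ cong (_* N ^ e) (trans (*-suc e M) (trans (+-comm e (e * M)) (cong (_+ e) (trans (*-comm e M) (sym N≡))))) ⟩
      (N + e) * N ^ e       ≤⟨ bernoulli N e ⟩
      N * suc N ^ e         ≡⟨ cong (_* suc N ^ e) (trans N≡ (*-comm M e)) ⟩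
      e * M * suc N ^ e     ≡⟨ *-assoc e M (suc N ^ e) ⟩
      e * (M * suc N ^ e)   ∎
  lower : d ^ e * N ^ N ≤ e ^ e * x ^ N
  lower = begin
    d ^ e * N ^ N             ≡⟨ cong (λ k → d ^ e * N ^ k) N≡ ⟩
    d ^ e * N ^ (M * e)       ≡⟨ cong (d ^ e *_) (^-*-assoc N M e) ⟨
    d ^ e * (N ^ M) ^ e       ≡⟨ ^-distribʳ-* e d (N ^ M) ⟨
    (d * N ^ M) ^ e           ≤⟨ ^-monoˡ-≤ e (+-cancelˡ-≤ (N ^ M) _ _ step) ⟩
    (e * x ^ M) ^ e           ≡⟨ ^-distribʳ-* e e (x ^ M) ⟩
    e ^ e * (x ^ M) ^ e       ≡⟨ cong (e ^ e *_) (^-*-assoc x M e) ⟩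
    e ^ e * x ^ (M * e)       ≡⟨ cong (λ k → e ^ e * x ^ k) N≡ ⟨
    e ^ e * x ^ N             ∎
    where
    regroup₁ : ∀ M e u → M * (e * u) ≡ u * (M * e)
    regroup₁ = solve-∀
    regroup₂ : ∀ M e u v → v * (M * e) + M * u ≡ M * (u + e * v)
    regroup₂ = solve-∀
    step : N ^ M + d * N ^ M ≤ N ^ M + e * x ^ M
    step = *-cancelˡ-≤ M $ begin
      M * (e * N ^ M)                   ≡⟨ regroup₁ M e (N ^ M) ⟩
      N ^ M * (M * e)                   ≡⟨ cong (N ^ M *_) N≡ ⟨
      N ^ M * N                         ≤⟨ bernoulli⁻ x M ⟩
      x ^ M * N + M * N ^ M             ≡⟨ cong (λ k → x ^ M * k + M * N ^ M) N≡ ⟩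
      x ^ M * (M * e) + M * N ^ M       ≡⟨ regroup₂ M e (N ^ M) (x ^ M) ⟩
      M * (N ^ M + e * x ^ M)           ∎

-- (1 + a/M)ᴹ ≤ (1 + 1/d)⁽ᵈ⁺¹⁾ᵃ
row-bound : ∀ M .{{_ : NonZero M}} d a →
            (M + a) ^ M * (d ^ suc d) ^ a ≤ M ^ M * (suc d ^ suc d) ^ a
row-bound M d a = *-cancelʳ-≤ _ _ ((M ^ M) ^ a) {{m^n≢0 (M ^ M) a {{m^n≢0 M M}}}} $ begin
  (M + a) ^ M * D ^ a * (M ^ M) ^ a           ≡⟨ *.xy∙z≈xz∙y ((M + a) ^ M) (D ^ a) _ ⟩
  (M + a) ^ M * (M ^ M) ^ a * D ^ a           ≡⟨ cong (λ z → (M + a) ^ M * z * D ^ a) (^-swap M) ⟩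
  (M + a) ^ M * (M ^ a) ^ M * D ^ a           ≡⟨ cong (_* D ^ a) (^-distribʳ-* M (M + a) (M ^ a)) ⟨
  -- Bernoulli replaces `1 + a/M` by `(1 + 1/M)ᵃ`; after regrouping, `euler-bounds` applies to
  -- `(1 + 1/M)ᴹ`, raised to the power `a`.
  ((M + a) * M ^ a) ^ M * D ^ a               ≤⟨ *-monoˡ-≤ (D ^ a) (^-monoˡ-≤ M (bernoulli M a)) ⟩
  (M * suc M ^ a) ^ M * D ^ a                 ≡⟨ cong (_* D ^ a) (trans (^-distribʳ-* M M (suc M ^ a)) (cong (M ^ M *_) (sym (^-swap (suc M))))) ⟩
  M ^ M * (suc M ^ M) ^ a * D ^ a             ≡⟨ trans (*-assoc (M ^ M) _ _) (cong (M ^ M *_) (sym (^-distribʳ-* a (suc M ^ M) D))) ⟩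
  M ^ M * (suc M ^ M * D) ^ a                 ≤⟨ *-monoʳ-≤ (M ^ M) (^-monoˡ-≤ a (euler-bounds M d)) ⟩
  M ^ M * (M ^ M * E) ^ a                     ≡⟨ cong (M ^ M *_) (trans (^-distribʳ-* a (M ^ M) E) (*-comm ((M ^ M) ^ a) (E ^ a))) ⟩
  M ^ M * (E ^ a * (M ^ M) ^ a)               ≡⟨ *-assoc (M ^ M) (E ^ a) _ ⟨
  M ^ M * E ^ a * (M ^ M) ^ a                 ∎
  where
  open ≤-Reasoning
  D = d ^ suc d
  E = suc d ^ suc d
  ^-swap : ∀ x → (x ^ M) ^ a ≡ (x ^ a) ^ M
  ^-swap x = trans (^-*-assoc x M a) (trans (cong (x ^_) (*-comm M a)) (sym (^-*-assoc x a M)))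

-- `row-bound` is multiplied over the rows, and the exponents `a` add up to the total weight of the
-- input. Dividing `totalWeight` by `(m * d) ^ p` gives the mean of `(1 + 1/d)^column`, so this
-- bounds the moment generating function.
totalWeight-bound : ∀ m .{{_ : NonZero m}} d .{{_ : NonZero d}} p f →
  totalWeight m d p f ^ (m * d) * (d ^ suc d) ^ ∑ (p * m) f ≤
  ((m * d) ^ p) ^ (m * d) * (suc d ^ suc d) ^ ∑ (p * m) f
totalWeight-bound m d zero    f = ≤-refl
totalWeight-bound m d (suc p) f = begin
  (R * P) ^ M * D ^ ∑ (m + p * m) f         ≡⟨ cong₂ _*_ (^-distribʳ-* M R P) (split D) ⟩
  R ^ M * P ^ M * (D ^ a * D ^ W)           ≡⟨ *.interchange (R ^ M) (P ^ M) (D ^ a) (D ^ W) ⟩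
  R ^ M * D ^ a * (P ^ M * D ^ W)           ≤⟨ *-mono-≤ (row-bound M {{m*n≢0 m d}} d a) (totalWeight-bound m d p (λ v → f (m + v))) ⟩
  M ^ M * E ^ a * ((M ^ p) ^ M * E ^ W)     ≡⟨ *.interchange (M ^ M) (E ^ a) ((M ^ p) ^ M) (E ^ W) ⟩
  M ^ M * (M ^ p) ^ M * (E ^ a * E ^ W)     ≡⟨ cong₂ _*_ (^-distribʳ-* M M (M ^ p)) (split E) ⟨
  (M * M ^ p) ^ M * E ^ ∑ (m + p * m) f     ∎
  where
  open ≤-Reasoning
  M = m * d
  D = d ^ suc d
  E = suc d ^ suc d
  a = ∑ m f
  R = M + a
  P = totalWeight m d p (λ v → f (m + v))
  W = ∑ (p * m) (λ v → f (m + v))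
  split : ∀ x → x ^ ∑ (m + p * m) f ≡ x ^ a * x ^ W
  split x = trans (cong (x ^_) (∑-split m (p * m) f)) (^-distribˡ-+-* x a W)

-- Upper and lower tails of a column sum.

bit-*-≤ : ∀ {P : Set} (P? : Dec P) {m n} → (P → m ≤ n) → bit (does P?) * m ≤ n
bit-*-≤ (no  _) _   = z≤n
bit-*-≤ (yes p) m≤n = ≤-trans (≤-reflexive (+-identityʳ _)) (m≤n p)

-- Chernoff bound.  The powers of 1 + 1/d that occur have fractional exponents with
-- denominator M = m d, so everything is raised to the M-th power.
upper-tail : ∀ m .{{_ : NonZero m}} d .{{_ : NonZero d}} p T Q f → (∀ v → f v ≤ 1) →
             p + d * Q ≤ d * T → ∀ j →
             ∑∈ (shifts p m) (λ σ → bit (does (∑ (p * m) f + m * T <? m * column m f σ j))) * suc d ^ Q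
             ≤ m ^ p * d ^ Q
upper-tail m d p T Q f f≤1 p+dQ≤dT j =
  ^-cancelˡ-≤ M {{m*n≢0 m d}} (subst₂ _≤_ (sym (^-distribʳ-* M N (e ^ Q))) (sym (^-distribʳ-* M (m ^ p) (d ^ Q)))
    (*-cancelʳ-≤ _ _ K {{m*n≢0 (e ^ V * e ^ r) (d ^ V) {{m*n≢0 (e ^ V) (e ^ r) {{m^n≢0 e V}} {{m^n≢0 e r}}}} {{m^n≢0 d V}}}} scaled))
  where
  open ≤-Reasoning
  e = suc d
  M = m * d
  W = ∑ (p * m) f
  V = e * W
  -- The least integer above `W / m + T`: a column that exceeds this fractional bound reaches `h`,
  -- so Markov's inequality needs only an integer exponent.
  h = suc ((W + m * T) / m)
  P = totalWeight m d p f
  exceeds : Vec ℕ p → ℕ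
  exceeds σ = bit (does (W + m * T <? m * column m f σ j))
  N = ∑∈ (shifts p m) exceeds

  module Exceeding (σ : Vec ℕ p) (lt : W + m * T < m * column m f σ j) where
    s = column m f σ j ∸ h
    h+s : h + s ≡ column m f σ j
    h+s = m+[n∸m]≡n (m<n*o⇒m/o<n (subst (W + m * T <_) (*-comm m _) lt))

  markov : N * (e ^ h * d ^ p) ≤ d ^ h * P
  markov = begin
    N * (e ^ h * d ^ p)                                    ≡⟨ ∑∈-distribʳ-* (shifts p m) exceeds (e ^ h * d ^ p) ⟨
    ∑∈ (shifts p m) (λ σ → exceeds σ * (e ^ h * d ^ p))    ≤⟨ ∑∈-mono (shifts p m) pointwise ⟩
    ∑∈ (shifts p m) (λ σ → d ^ h * weight m d f j σ)       ≡⟨ ∑∈-distribˡ-* (shifts p m) (weight m d f j) (d ^ h) ⟩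
    d ^ h * ∑∈ (shifts p m) (weight m d f j)               ≡⟨ cong (d ^ h *_) (∑∈-weight m d p f j) ⟩
    d ^ h * P                                              ∎
    where
    pointwise : ∀ σ → exceeds σ * (e ^ h * d ^ p) ≤ d ^ h * weight m d f j σ
    pointwise σ = bit-*-≤ (_ <? _) λ lt → let open Exceeding σ lt in *-cancelʳ-≤ _ _ (d ^ s) {{m^n≢0 d s}} $ begin
      e ^ h * d ^ p * d ^ s                      ≡⟨ *.xy∙z≈xz∙y (e ^ h) (d ^ p) (d ^ s) ⟩
      e ^ h * d ^ s * d ^ p                      ≤⟨ *-monoˡ-≤ (d ^ p) (*-monoʳ-≤ (e ^ h) (^-monoˡ-≤ s (n≤1+n d))) ⟩
      e ^ h * e ^ s * d ^ p                      ≡⟨ cong (_* d ^ p) (trans (cong (e ^_) (sym h+s)) (^-distribˡ-+-* e h s)) ⟨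
      e ^ column m f σ j * d ^ p                 ≡⟨ weight-column m d f j σ f≤1 ⟨
      weight m d f j σ * d ^ column m f σ j      ≡⟨ cong (weight m d f j σ *_) (trans (cong (d ^_) (sym h+s)) (^-distribˡ-+-* d h s)) ⟩
      weight m d f j σ * (d ^ h * d ^ s)         ≡⟨ *.x∙yz≈yx∙z (weight m d f j σ) (d ^ h) (d ^ s) ⟩
      d ^ h * weight m d f j σ * d ^ s           ∎

  -- In units of `1/M`, the exponent `V` of the moment plus `Q` stays below `h`. The part of `V`
  -- beyond `d * W` is `W ≤ p * m`, and `p + d * Q ≤ d * T` absorbs it.
  exponents : V + Q * M ≤ h * M
  exponents = begin
    V + Q * M                   ≡⟨ regroup₁ d W Q m ⟩
    W + (d * W + m * (d * Q))   ≤⟨ +-monoˡ-≤ _ W≤pm ⟩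
    p * m + (d * W + m * (d * Q)) ≡⟨ regroup₂ p m (d * W) (d * Q) ⟩
    d * W + m * (p + d * Q)     ≤⟨ +-monoʳ-≤ (d * W) (*-monoʳ-≤ m p+dQ≤dT) ⟩
    d * W + m * (d * T)         ≡⟨ regroup₃ d W m T ⟩
    (W + m * T) * d             ≤⟨ *-monoˡ-≤ d W+mT≤hm ⟩
    h * m * d                   ≡⟨ *-assoc h m d ⟩
    h * M                       ∎
    where
    regroup₁ : ∀ d W Q m → suc d * W + Q * (m * d) ≡ W + (d * W + m * (d * Q))
    regroup₁ = solve-∀
    regroup₂ : ∀ p m x y → p * m + (x + m * y) ≡ x + m * (p + y)
    regroup₂ = solve-∀
    regroup₃ : ∀ d W m T → d * W + m * (d * T) ≡ (W + m * T) * d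
    regroup₃ = solve-∀
    W≤pm : W ≤ p * m
    W≤pm = ≤-trans (∑-mono (p * m) λ v _ → f≤1 v) (≤-reflexive (trans (∑-const (p * m) 1) (*-identityʳ _)))
    W+mT≤hm : W + m * T ≤ h * m
    W+mT≤hm = begin
      W + m * T                                     ≡⟨ m≡m%n+[m/n]*n (W + m * T) m ⟩
      (W + m * T) % m + (W + m * T) / m * m         ≤⟨ +-monoˡ-≤ _ (m%n≤n (W + m * T) m) ⟩
      h * m                                         ∎

  -- The slack in `exponents`. Raising the leftover `d ^ r` to `e ^ r` gives both sides of `scaled`
  -- the common factor `K`.
  r = h * M ∸ (V + Q * M)

  K = e ^ V * e ^ r * d ^ V

  expand : ∀ x → (x ^ h) ^ M ≡ x ^ V * (x ^ Q) ^ M * x ^ r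
  expand x = begin-equality
    (x ^ h) ^ M                     ≡⟨ ^-*-assoc x h M ⟩
    x ^ (h * M)                     ≡⟨ cong (x ^_) (m+[n∸m]≡n exponents) ⟨
    x ^ (V + Q * M + r)             ≡⟨ ^-distribˡ-+-* x (V + Q * M) r ⟩
    x ^ (V + Q * M) * x ^ r         ≡⟨ cong (_* x ^ r) (trans (^-distribˡ-+-* x V (Q * M)) (cong (x ^ V *_) (sym (^-*-assoc x Q M)))) ⟩
    x ^ V * (x ^ Q) ^ M * x ^ r     ∎

  powered : N ^ M * (e ^ h) ^ M * d ^ V ≤ (d ^ h) ^ M * ((m ^ p) ^ M * e ^ V)
  powered = *-cancelʳ-≤ _ _ ((d ^ p) ^ M) {{m^n≢0 (d ^ p) M {{m^n≢0 d p}}}} $ begin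
    N ^ M * (e ^ h) ^ M * d ^ V * (d ^ p) ^ M         ≡⟨ regroup₁ (N ^ M) ((e ^ h) ^ M) (d ^ V) ((d ^ p) ^ M) ⟩
    N ^ M * ((e ^ h) ^ M * (d ^ p) ^ M) * d ^ V       ≡⟨ cong (_* d ^ V) (trans (^-distribʳ-* M N (e ^ h * d ^ p)) (cong (N ^ M *_) (^-distribʳ-* M (e ^ h) (d ^ p)))) ⟨
    (N * (e ^ h * d ^ p)) ^ M * d ^ V                 ≤⟨ *-monoˡ-≤ (d ^ V) (^-monoˡ-≤ M markov) ⟩
    (d ^ h * P) ^ M * d ^ V                           ≡⟨ cong₂ _*_ (^-distribʳ-* M (d ^ h) P) (sym (^-*-assoc d e W)) ⟩
    (d ^ h) ^ M * P ^ M * (d ^ e) ^ W                 ≡⟨ *-assoc ((d ^ h) ^ M) (P ^ M) _ ⟩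
    (d ^ h) ^ M * (P ^ M * (d ^ e) ^ W)               ≤⟨ *-monoʳ-≤ ((d ^ h) ^ M) (totalWeight-bound m d p f) ⟩
    (d ^ h) ^ M * ((M ^ p) ^ M * (e ^ e) ^ W)         ≡⟨ cong ((d ^ h) ^ M *_) (cong₂ _*_ (trans (cong (_^ M) (^-distribʳ-* p m d)) (^-distribʳ-* M (m ^ p) (d ^ p))) (^-*-assoc e e W)) ⟩
    (d ^ h) ^ M * ((m ^ p) ^ M * (d ^ p) ^ M * e ^ V) ≡⟨ regroup₂ ((d ^ h) ^ M) ((m ^ p) ^ M) ((d ^ p) ^ M) (e ^ V) ⟩
    (d ^ h) ^ M * ((m ^ p) ^ M * e ^ V) * (d ^ p) ^ M ∎
    where
    regroup₁ : ∀ x y z w → x * y * z * w ≡ x * (y * w) * z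
    regroup₁ = solve-∀
    regroup₂ : ∀ x y z w → x * (y * z * w) ≡ x * (y * w) * z
    regroup₂ = solve-∀

  scaled : N ^ M * (e ^ Q) ^ M * K ≤ (m ^ p) ^ M * (d ^ Q) ^ M * K
  scaled = begin
    N ^ M * (e ^ Q) ^ M * (e ^ V * e ^ r * d ^ V)         ≡⟨ regroup₁ (N ^ M) ((e ^ Q) ^ M) (e ^ V) (e ^ r) (d ^ V) ⟩
    N ^ M * (e ^ V * (e ^ Q) ^ M * e ^ r) * d ^ V         ≡⟨ cong (λ x → N ^ M * x * d ^ V) (expand e) ⟨
    N ^ M * (e ^ h) ^ M * d ^ V                           ≤⟨ powered ⟩
    (d ^ h) ^ M * ((m ^ p) ^ M * e ^ V)                   ≡⟨ cong (_* ((m ^ p) ^ M * e ^ V)) (expand d) ⟩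
    d ^ V * (d ^ Q) ^ M * d ^ r * ((m ^ p) ^ M * e ^ V)   ≤⟨ *-monoˡ-≤ ((m ^ p) ^ M * e ^ V) (*-monoʳ-≤ (d ^ V * (d ^ Q) ^ M) (^-monoˡ-≤ r (n≤1+n d))) ⟩
    d ^ V * (d ^ Q) ^ M * e ^ r * ((m ^ p) ^ M * e ^ V)   ≡⟨ regroup₂ (d ^ V) ((d ^ Q) ^ M) (e ^ r) ((m ^ p) ^ M) (e ^ V) ⟩
    (m ^ p) ^ M * (d ^ Q) ^ M * (e ^ V * e ^ r * d ^ V)   ∎
    where
    regroup₁ : ∀ x y z w u → x * y * (z * w * u) ≡ x * (z * y * w) * u
    regroup₁ = solve-∀
    regroup₂ : ∀ x y z w u → x * y * z * (w * u) ≡ w * y * (u * z * x)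
    regroup₂ = solve-∀

-- The upper tail for the flipped bits: the flipped total and column sum are `m * p` and `p` minus
-- the original ones, so the two events coincide, and the condition on `p`, `Q`, `T` does not
-- change.
lower-tail : ∀ m .{{_ : NonZero m}} d .{{_ : NonZero d}} p T Q f → (∀ v → f v ≤ 1) →
             p + d * Q ≤ d * T → ∀ j →
             ∑∈ (shifts p m) (λ σ → bit (does (m * (column m f σ j + T) <? ∑ (p * m) f))) * suc d ^ Q
             ≤ m ^ p * d ^ Q
lower-tail m d p T Q f f≤1 p+dQ≤dT j =
  ≤-trans (*-monoˡ-≤ (suc d ^ Q) (≤-reflexive (∑∈-cong (shifts p m) λ σ → cong bit (flipped σ))))
          (upper-tail m d p T Q f⁻ (λ v → m∸n≤m 1 (f v)) p+dQ≤dT j)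
  where
  f⁻ : ℕ → ℕ
  f⁻ v = 1 ∸ f v
  W = ∑ (p * m) f
  W⁻ = ∑ (p * m) f⁻
  W+W⁻ : W + W⁻ ≡ m * p
  W+W⁻ = begin
    W + W⁻                                ≡⟨ ∑-+ (p * m) f f⁻ ⟨
    ∑ (p * m) (λ v → f v + (1 ∸ f v))     ≡⟨ ∑-cong (p * m) (λ v → m+[n∸m]≡n (f≤1 v)) ⟩
    ∑ (p * m) (λ _ → 1)                   ≡⟨ trans (∑-const (p * m) 1) (trans (*-identityʳ _) (*-comm p m)) ⟩
    m * p                                 ∎
    where open ≡-Reasoning
  flipped : ∀ σ → does (m * (column m f σ j + T) <? W) ≡ does (W⁻ + m * T <? m * column m f⁻ σ j)
  flipped σ = does-⇔ (mk⇔
    (λ lt → +-cancelˡ-< (m * S) _ _ (subst₂ _<_ eq₁ eq₂ (+-monoʳ-< W⁻ lt)))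
    (λ lt → +-cancelˡ-< W⁻ _ _ (subst₂ _<_ (sym eq₁) (sym eq₂) (+-monoʳ-< (m * S) lt))))
    (_ <? _) (_ <? _)
    where
    S = column m f σ j
    S⁻ = column m f⁻ σ j
    eq₁ : W⁻ + m * (S + T) ≡ m * S + (W⁻ + m * T)
    eq₁ = regroup W⁻ m S T
      where
      regroup : ∀ w m s t → w + m * (s + t) ≡ m * s + (w + m * t)
      regroup = solve-∀
    eq₂ : W⁻ + W ≡ m * S + m * S⁻
    eq₂ = trans (+-comm W⁻ W) (trans W+W⁻ (trans (cong (m *_) (sym (column-complement m f σ j f≤1))) (*-distribˡ-+ m S S⁻)))

-- Unit-weight gates and the layout of the variables in blocks.

⊖≤+⇔ : ∀ a b s → (a ⊖ b ℤ.≤ ℤ.+ s) ⇔ (a ≤ b + s)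
⊖≤+⇔ a b s = mk⇔
  (λ le → ℤ.drop‿+≤+ (subst₂ ℤ._≤_ a≡ (cong ℤ.+_ (+-comm s b)) (ℤ.+-monoˡ-≤ (ℤ.+ b) le)))
  (λ le → subst (a ⊖ b ℤ.≤_) s≡ (ℤ.⊖-monoˡ-≤ b le))
  where
  a≡ : (a ⊖ b) ℤ.+ ℤ.+ b ≡ ℤ.+ a
  a≡ = trans (ℤ.distribˡ-⊖-+-pos b a b) (trans (cong (_⊖ b) (+-comm a b)) (trans (ℤ.⊖-≥ (m≤m+n b a)) (cong ℤ.+_ (m+n∸m≡n b a))))
  s≡ : (b + s) ⊖ b ≡ ℤ.+ s
  s≡ = trans (ℤ.⊖-≥ (m≤m+n b s)) (cong ℤ.+_ (m+n∸m≡n b s))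

module _ {k : ℕ} {I : Set} where

  ∑∈-unit : ∀ (xs : List I) (f : I → ℕ) → sum (map (λ (c , i) → c * f i) (map (1 ,_) xs)) ≡ ∑∈ xs f
  ∑∈-unit xs f = trans (cong sum (sym (map-∘ xs))) (∑∈-cong xs λ i → +-identityʳ (f i))

  -- The threshold is the integer `a - b`, possibly negative; keeping `a` and `b` apart makes the
  -- test `a ≤ b + sum`, free of truncated subtraction.
  unitGate : (xs : List I) → length xs ≤ k → ℕ → ℕ → Gate k I
  unitGate xs ∣xs∣≤k a b = record
    { inputs    = map (1 ,_) xs
    ; positive  = All.map⁺ (All.universal (λ _ → z<s) xs)
    ; bounded   = ≤-trans (≤-reflexive (weights xs)) ∣xs∣≤k
    ; threshold = a ⊖ b
    }
    where
    weights : (xs : List I) → sum (map proj₁ (map {B = ℕ × I} (1 ,_) xs)) ≡ length xs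
    weights []       = refl
    weights (x ∷ xs) = cong suc (weights xs)

  evalGate-unitGate : ∀ xs (b≤ : length xs ≤ k) a b z →
                      evalGate (unitGate xs b≤ a b) z ≡ does (a ≤? b + ∑∈ xs (bit ∘ z))
  evalGate-unitGate xs b≤ a b z =
    trans (cong (λ s → does (a ⊖ b ℤ.≤? ℤ.+ s)) (∑∈-unit xs (bit ∘ z)))
          (does-⇔ (⊖≤+⇔ a b _) (_ ℤ.≤? _) (_ ≤? _))

padded : ∀ {n} → Vec Bool n → ℕ → ℕ
padded []      v       = 0
padded (b ∷ x) zero    = bit b
padded (b ∷ x) (suc v) = padded x v

-- A list because positions from `n` on hold no variable: the empty list contributes the same 0 as
-- the default of `padded`.
cell : ∀ n → ℕ → List (Fin n)
cell zero    v       = []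
cell (suc n) zero    = zero ∷ []
cell (suc n) (suc v) = map suc (cell n v)

bit≤1 : ∀ b → bit b ≤ 1
bit≤1 false = z≤n
bit≤1 true  = ≤-refl

padded≤1 : ∀ {n} (x : Vec Bool n) v → padded x v ≤ 1
padded≤1 []      v       = z≤n
padded≤1 (b ∷ x) zero    = bit≤1 b
padded≤1 (b ∷ x) (suc v) = padded≤1 x v

∑-padded : ∀ {n} (x : Vec Bool n) N → n ≤ N → ∑ N (padded x) ≡ Vec.sum (Vec.map bit x)
∑-padded []      N       _         = trans (∑-const N 0) (*-zeroʳ N)
∑-padded (b ∷ x) (suc N) (s≤s n≤N) = cong (bit b +_) (∑-padded x N n≤N)

∑∈-cell : ∀ {n} (x : Vec Bool n) v → ∑∈ (cell n v) (bit ∘ lookup x) ≡ padded x v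
∑∈-cell []      v       = refl
∑∈-cell (b ∷ x) zero    = +-identityʳ (bit b)
∑∈-cell {suc n} (b ∷ x) (suc v) = trans (∑∈-map suc (cell n v) _) (∑∈-cell x v)

length-cell : ∀ n v → length (cell n v) ≤ 1
length-cell zero    v       = z≤n
length-cell (suc n) zero    = ≤-refl
length-cell (suc n) (suc v) = ≤-trans (≤-reflexive (length-map suc (cell n v))) (length-cell n v)

length-concat-applyUpTo : ∀ {A : Set} m H (g : ℕ → ℕ → A) → length (concat (applyUpTo (λ j → applyUpTo (g j) H) m)) ≡ m * H
length-concat-applyUpTo zero    H g = refl
length-concat-applyUpTo (suc m) H g =
  trans (length-++ (applyUpTo (g 0) H)) (cong₂ _+_ (length-applyUpTo (g 0) H) (length-concat-applyUpTo m H (g ∘ suc)))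

module _ (m : ℕ) .{{_ : NonZero m}} {I : Set} where

  block : ∀ {p} → (ℕ → List I) → Vec ℕ p → ℕ → List I
  block c []      j = []
  block c (s ∷ σ) j = c ((j + s) % m) ++ block (λ v → c (m + v)) σ j

  length-block : ∀ {p} c (σ : Vec ℕ p) j → (∀ v → length (c v) ≤ 1) → length (block c σ j) ≤ p
  length-block c []      j c≤1 = z≤n
  length-block c (s ∷ σ) j c≤1 =
    ≤-trans (≤-reflexive (length-++ (c _))) (+-mono-≤ (c≤1 _) (length-block _ σ j (c≤1 ∘ (m +_))))

  ∑∈-block : ∀ {p} c (σ : Vec ℕ p) j g f → (∀ v → ∑∈ (c v) g ≡ f v) →
             ∑∈ (block c σ j) g ≡ column m f σ j
  ∑∈-block c []      j g f eq = refl
  ∑∈-block c (s ∷ σ) j g f eq =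
    trans (∑∈-++ (c _) _ g) (cong₂ _+_ (eq _) (∑∈-block _ σ j g _ (eq ∘ (m +_))))

-- Clipped block sums and the decision made from them.

-- Unary counting: the tests that succeed are those with `h < y ∸ e`. The induction removes the
-- lowest test and raises `e` by one.
∑-thresholds : ∀ H e y → ∑ H (λ h → bit (does (suc h + e ≤? y))) ≡ (y ∸ e) ⊓ H
∑-thresholds zero    e y = sym (⊓-zeroʳ (y ∸ e))
∑-thresholds (suc H) e y = begin
  bit (does (suc e ≤? y)) + ∑ H (λ h → bit (does (suc (suc h) + e ≤? y)))
    ≡⟨ cong₂ _+_ refl (trans (∑-cong H λ h → cong (λ z → bit (does (suc z ≤? y))) (sym (+-suc h e))) (∑-thresholds H (suc e) y)) ⟩
  bit (does (suc e ≤? y)) + (y ∸ suc e) ⊓ H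
    ≡⟨ step (suc e ≤? y) ⟩
  (y ∸ e) ⊓ suc H ∎
  where
  open ≡-Reasoning
  step : (e<y? : Dec (e < y)) → bit (does e<y?) + (y ∸ suc e) ⊓ H ≡ (y ∸ e) ⊓ suc H
  step (yes e<y) = cong (_⊓ suc H) (sym (+-∸-assoc 1 e<y))
  step (no  e≮y) = trans (cong (_⊓ H) (m≤n⇒m∸n≡0 (m≤n⇒m≤1+n (≮⇒≥ e≮y)))) (cong (_⊓ suc H) (sym (m≤n⇒m∸n≡0 (≮⇒≥ e≮y))))

n≤2*w⇔⌈n/2⌉≤w : ∀ n w → (⌈ n /2⌉ ≤ w) ⇔ (n ≤ 2 * w)
n≤2*w⇔⌈n/2⌉≤w n w = mk⇔
  (λ le → ≤-trans (≤-reflexive (sym (⌊n/2⌋+⌈n/2⌉≡n n)))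
            (≤-trans (+-mono-≤ (≤-trans (⌊n/2⌋≤⌈n/2⌉ n) le) le) (≤-reflexive (sym w+w))))
  (λ le → ≤-trans (⌈n/2⌉-mono le) (≤-reflexive (trans (cong ⌈_/2⌉ w+w) (sym (n≡⌈n+n/2⌉ w)))))
  where
  w+w : 2 * w ≡ w + w
  w+w = cong (w +_) (+-identityʳ w)

-- If every block sum s j is within T of the average W/m, then clipping the sums to the
-- window of radius 2T around w/m does not change the comparison of W with w: either
-- no block is clipped, or W/m is so far from w/m that all blocks are on the right side.
module Window (m : ℕ) .{{_ : NonZero m}} (T : ℕ) .{{_ : NonZero T}} (w e : ℕ)
              (me≤w : m * e ≤ w) (w≤m[1+e] : w ≤ m * suc e)
              (s : ℕ → ℕ) (W : ℕ) (W≡ : W ≡ ∑ m s)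
              (upper : ∀ j → j < m → m * s j ≤ W + m * T)
              (lower : ∀ j → j < m → W ≤ m * (s j + T))
              where

  H : ℕ
  H = (T + T) + (T + T)

  -- Adding `T + T` before subtracting `e` avoids a negative lower end: `e + clip j` equals
  -- `(T + T) + s j` exactly when `s j` is within `T + T` of `e`.
  clip : ℕ → ℕ
  clip j = ((T + T) + s j ∸ e) ⊓ H

  clip-≥ : ∀ j {v} → v ≤ (T + T) + s j → v ≤ e + H → v ≤ e + clip j
  clip-≥ j v≤y v≤e+H =
    ≤-trans (⊓-glb (≤-trans v≤y (m≤n+m∸n _ e)) v≤e+H) (≤-reflexive (sym (+-distribˡ-⊓ e _ H)))

  clip-≤ : ∀ j {v} → (T + T) + s j ≤ v → e ≤ v → e + clip j ≤ v
  clip-≤ j y≤v e≤v =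
    ≤-trans (+-monoʳ-≤ e (≤-trans (m⊓n≤m _ H) (∸-monoˡ-≤ e y≤v))) (≤-reflexive (m+[n∸m]≡n e≤v))

  total : m * e + ∑ m clip ≡ ∑ m (λ j → e + clip j)
  total = sym (trans (∑-+ m (λ _ → e) clip) (cong (_+ ∑ m clip) (∑-const m e)))

  shifted : ∑ m (λ j → (T + T) + s j) ≡ W + m * (T + T)
  shifted = trans (∑-+ m _ s) (trans (cong₂ _+_ (∑-const m (T + T)) (sym W≡)) (+-comm _ W))

  open ≤-Reasoning

  -- Clipping from below only raises the sum, so the near case has to exclude clipping from above
  -- alone. In `reject` the roles are exchanged.
  accept : w ≤ W → w + m * (T + T) ≤ m * e + ∑ m clip
  accept w≤W with W ≤? m * (e + T)
  ... | yes near = begin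
    w + m * (T + T)                  ≤⟨ +-monoˡ-≤ _ w≤W ⟩
    W + m * (T + T)                  ≡⟨ shifted ⟨
    ∑ m (λ j → (T + T) + s j)        ≤⟨ ∑-mono m (λ j j<m → clip-≥ j ≤-refl (unclipped j j<m)) ⟩
    ∑ m (λ j → e + clip j)           ≡⟨ total ⟨
    m * e + ∑ m clip                 ∎
    where
    regroup : ∀ m e T → m * (e + T) + m * T ≡ m * (e + (T + T))
    regroup = solve-∀
    unclipped : ∀ j → j < m → (T + T) + s j ≤ e + H
    unclipped j j<m = begin
      (T + T) + s j              ≤⟨ +-monoʳ-≤ (T + T) (*-cancelˡ-≤ m (≤-trans (upper j j<m) (≤-trans (+-monoˡ-≤ (m * T) near) (≤-reflexive (regroup m e T))))) ⟩
      (T + T) + (e + (T + T))    ≡⟨ +.x∙yz≈y∙xz (T + T) e (T + T) ⟩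
      e + H                      ∎
  ... | no far = begin
    w + m * (T + T)                  ≤⟨ +-monoˡ-≤ _ w≤m[1+e] ⟩
    m * suc e + m * (T + T)          ≡⟨ *-distribˡ-+ m (suc e) (T + T) ⟨
    m * (suc e + (T + T))            ≡⟨ ∑-const m _ ⟨
    ∑ m (λ _ → suc e + (T + T))      ≤⟨ ∑-mono m (λ j j<m → clip-≥ j (≤-trans (+-monoˡ-≤ (T + T) (e<s j j<m)) (≤-reflexive (+-comm (s j) _))) in-window) ⟩
    ∑ m (λ j → e + clip j)           ≡⟨ total ⟨
    m * e + ∑ m clip                 ∎
    where
    e<s : ∀ j → j < m → e < s j
    e<s j j<m = +-cancelʳ-< T e (s j) (*-cancelˡ-< m (e + T) (s j + T) (<-≤-trans (≰⇒> far) (lower j j<m)))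
    -- The guaranteed surplus of one over `e` must fit under the upper clip, which holds since `T`
    -- is nonzero.
    in-window : suc e + (T + T) ≤ e + H
    in-window = begin
      suc e + (T + T)          ≡⟨ +-suc e (T + T) ⟨
      e + (1 + (T + T))        ≤⟨ +-monoʳ-≤ e (+-monoˡ-≤ (T + T) (≤-trans (>-nonZero⁻¹ T) (m≤m+n T T))) ⟩
      e + H                    ∎

  reject : W < w → m * e + ∑ m clip < w + m * (T + T)
  reject W<w with m * e ≤? W + m * T
  ... | yes near = begin-strict
    m * e + ∑ m clip               ≡⟨ total ⟩
    ∑ m (λ j → e + clip j)         ≤⟨ ∑-mono m (λ j j<m → clip-≤ j ≤-refl (unclipped j j<m)) ⟩
    ∑ m (λ j → (T + T) + s j)      ≡⟨ shifted ⟩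
    W + m * (T + T)                <⟨ +-monoˡ-< (m * (T + T)) W<w ⟩
    w + m * (T + T)                ∎
    where
    regroup : ∀ m s T → m * (s + T) + m * T ≡ m * ((T + T) + s)
    regroup = solve-∀
    unclipped : ∀ j → j < m → e ≤ (T + T) + s j
    unclipped j j<m = *-cancelˡ-≤ m (≤-trans near (≤-trans (+-monoˡ-≤ (m * T) (lower j j<m)) (≤-reflexive (regroup m (s j) T))))
  ... | no far = begin-strict
    m * e + ∑ m clip               ≡⟨ total ⟩
    ∑ m (λ j → e + clip j)         ≤⟨ ∑-mono m (λ j j<m → clip-≤ j (bound j j<m) (m≤m+n e _)) ⟩
    ∑ m (λ _ → e + pred (T + T))   ≡⟨ ∑-const m _ ⟩
    -- Each block lies below `e` and so loses at least one; as `m` is nonzero, the inequality is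
    -- strict.
    m * (e + pred (T + T))         <⟨ *-monoʳ-< m (+-monoʳ-< e (≤-reflexive pred-2T)) ⟩
    m * (e + (T + T))              ≡⟨ *-distribˡ-+ m e (T + T) ⟩
    m * e + m * (T + T)            ≤⟨ +-monoˡ-≤ _ me≤w ⟩
    w + m * (T + T)                ∎
    where
    pred-2T : suc (pred (T + T)) ≡ T + T
    pred-2T = suc-pred (T + T) {{>-nonZero (≤-trans (>-nonZero⁻¹ T) (m≤m+n T T))}}
    s<e : ∀ j → j < m → s j < e
    s<e j j<m = *-cancelˡ-< m (s j) e (≤-<-trans (upper j j<m) (≰⇒> far))
    bound : ∀ j → j < m → (T + T) + s j ≤ e + pred (T + T)
    bound j j<m = begin
      (T + T) + s j                  ≡⟨ cong (_+ s j) pred-2T ⟨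
      suc (pred (T + T)) + s j       ≡⟨ trans (sym (+-suc _ (s j))) (+-comm _ (suc (s j))) ⟩
      suc (s j) + pred (T + T)       ≤⟨ +-monoˡ-≤ _ (s<e j j<m) ⟩
      e + pred (T + T)               ∎

  window : (w + m * (T + T) ≤ m * e + ∑ m clip) ⇔ (w ≤ W)
  window = mk⇔ (λ acc → ≮⇒≥ λ W<w → <⇒≱ (reject W<w) acc) accept

-- The circuit for given shifts, and the number of shifts on which it errs.

∑≡0 : ∀ n f → ∑ n f ≡ 0 → ∀ i → i < n → f i ≡ 0
∑≡0 (suc n) f eq zero    _         = m+n≡0⇒m≡0 (f 0) eq
∑≡0 (suc n) f eq (suc i) (s<s i<n) = ∑≡0 n (f ∘ suc) (m+n≡0⇒n≡0 (f 0) eq) i i<n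

bit-<?≡0 : ∀ a b → bit (does (a <? b)) ≡ 0 → b ≤ a
bit-<?≡0 a b eq = ≮⇒≥ λ a<b → 0≢1+n (trans (sym eq) (cong bit (dec-true (a <? b) a<b)))

module Construction (n m : ℕ) .{{_ : NonZero m}} (p T : ℕ) .{{_ : NonZero T}} (k : ℕ)
                    (p≤k : p ≤ k) (gates≤k : m * (4 * T) ≤ k) (n≤pm : n ≤ p * m) where

  w e H : ℕ
  w = ⌈ n /2⌉
  e = w / m
  H = (T + T) + (T + T)

  block-fits : ∀ σ j → length (block m (cell n) σ j) ≤ k
  block-fits σ j = ≤-trans (length-block m (cell n) σ j (length-cell n)) p≤k

  bottom : Vec ℕ p → ℕ → ℕ → Gate k (Fin n)
  bottom σ j h = unitGate (block m (cell n) σ j) (block-fits σ j) (suc h + e) (T + T)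

  gates : Vec ℕ p → List (Gate k (Fin n))
  gates σ = concat (applyUpTo (λ j → applyUpTo (bottom σ j) H) m)

  gates-fit : ∀ σ → length (gates σ) ≤ k
  gates-fit σ = ≤-trans (≤-reflexive (trans (length-concat-applyUpTo m H (bottom σ)) (cong (m *_) (regroup T)))) gates≤k
    where
    regroup : ∀ T → (T + T) + (T + T) ≡ 4 * T
    regroup = solve-∀

  -- Without clipping, `m * e` plus the number of firing gates is `W + m * (T + T)`, so this
  -- threshold tests `w ≤ W`.
  circuit : Vec ℕ p → Circuit k n
  circuit σ = unitGate (gates σ) (gates-fit σ) (w + m * (T + T)) (m * e)

  module _ (x : Vec Bool n) where

    s : Vec ℕ p → ℕ → ℕ
    s = column m (padded x)

    W : ℕ
    W = ∑ (p * m) (padded x)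

    eval-bottom : ∀ σ j h → evalGate (bottom σ j h) (lookup x) ≡ does (suc h + e ≤? (T + T) + s σ j)
    eval-bottom σ j h =
      trans (evalGate-unitGate (block m (cell n) σ j) (block-fits σ j) (suc h + e) (T + T) (lookup x))
            (cong (λ z → does (suc h + e ≤? (T + T) + z)) (∑∈-block m (cell n) σ j (bit ∘ lookup x) (padded x) (∑∈-cell x)))

    eval-circuit : ∀ σ → eval (circuit σ) x ≡
                   does (w + m * (T + T) ≤? m * e + ∑ m (λ j → ((T + T) + s σ j ∸ e) ⊓ H))
    eval-circuit σ =
      trans (evalGate-unitGate (gates σ) (gates-fit σ) (w + m * (T + T)) (m * e) (λ g → evalGate g (lookup x)))
            (cong (λ z → does (w + m * (T + T) ≤? m * e + z))
                  (trans (∑∈-concat-applyUpTo m (λ j → applyUpTo (bottom σ j) H) fires) (∑-cong m λ j → trans (row j) (∑-thresholds H e ((T + T) + s σ j)))))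
      where
      fires : Gate k (Fin n) → ℕ
      fires g = bit (evalGate g (lookup x))
      ∑∈-applyUpTo : ∀ H (g : ℕ → Gate k (Fin n)) → ∑∈ (applyUpTo g H) fires ≡ ∑ H (fires ∘ g)
      ∑∈-applyUpTo zero    g = refl
      ∑∈-applyUpTo (suc H) g = cong (fires (g 0) +_) (∑∈-applyUpTo H (g ∘ suc))
      row : ∀ j → ∑∈ (applyUpTo (bottom σ j) H) fires ≡ ∑ H (λ h → bit (does (suc h + e ≤? (T + T) + s σ j)))
      row j = trans (∑∈-applyUpTo H (bottom σ j)) (∑-cong H λ h → cong bit (eval-bottom σ j h))

    above below : ℕ → Vec ℕ p → ℕ
    above j σ = bit (does (W + m * T <? m * s σ j))
    below j σ = bit (does (m * (s σ j + T) <? W))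

    deviations : Vec ℕ p → ℕ → ℕ
    deviations σ j = above j σ + below j σ

    correct : ∀ σ → ∑ m (deviations σ) ≡ 0 → eval (circuit σ) x ≡ MAJ x
    correct σ none = trans (eval-circuit σ) (does-⇔ accepts⇔ (_ ≤? _) (_ ≤? _))
      where
      none′ : ∀ j → j < m → deviations σ j ≡ 0
      none′ = ∑≡0 m (deviations σ) none
      me≤w : m * e ≤ w
      me≤w = ≤-trans (≤-reflexive (*-comm m e)) (m/n*n≤m w m)
      w≤ : w ≤ m * suc e
      w≤ = begin
        w                   ≡⟨ m≡m%n+[m/n]*n w m ⟩
        w % m + w / m * m   ≤⟨ +-monoˡ-≤ _ (m%n≤n w m) ⟩
        suc e * m           ≡⟨ *-comm (suc e) m ⟩
        m * suc e           ∎
        where open ≤-Reasoning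
      open Window m T w e me≤w w≤ (s σ) W (sym (column-total m (padded x) σ))
        (λ j j<m → bit-<?≡0 _ _ (m+n≡0⇒m≡0 _ (none′ j j<m)))
        (λ j j<m → bit-<?≡0 _ _ (m+n≡0⇒n≡0 (above j σ) (none′ j j<m)))
        using (window)
      accepts⇔ : (w + m * (T + T) ≤ m * e + ∑ m (λ j → ((T + T) + s σ j ∸ e) ⊓ H)) ⇔
                 (n ≤ 2 * Vec.sum (Vec.map bit x))
      accepts⇔ = subst (λ z → (w + m * (T + T) ≤ m * e + ∑ m (λ j → ((T + T) + s σ j ∸ e) ⊓ H)) ⇔ (n ≤ 2 * z))
        (∑-padded x (p * m) n≤pm)
        (mk⇔ (Equivalence.to (n≤2*w⇔⌈n/2⌉≤w n W) ∘ Equivalence.to window)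
             (Equivalence.from window ∘ Equivalence.from (n≤2*w⇔⌈n/2⌉≤w n W)))

    errs : Vec ℕ p → ℕ
    errs σ = bit (eval (circuit σ) x xor MAJ x)

    -- Union bound: an error forces at least one deviating block, and the deviations are counted
    -- with multiplicity.
    errs≤deviations : ∀ σ → errs σ ≤ ∑ m (deviations σ)
    errs≤deviations σ with ∑ m (deviations σ) in eq
    ... | zero  = ≤-reflexive (cong bit (trans (cong (_xor MAJ x) (correct σ eq)) (xor-same (MAJ x))))
    ... | suc _ = ≤-trans (bit≤1 _) (s≤s z≤n)

    errors : ℕ
    errors = ∑∈ (shifts p m) errs

    errors-bound : ∀ d .{{_ : NonZero d}} Q → p + d * Q ≤ d * T →
                   errors * suc d ^ Q ≤ (m + m) * (m ^ p * d ^ Q)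
    errors-bound d Q p+dQ≤dT = begin
      errors * E
        ≤⟨ *-monoˡ-≤ E (∑∈-mono (shifts p m) errs≤deviations) ⟩
      ∑∈ (shifts p m) (λ σ → ∑ m (deviations σ)) * E
        ≡⟨ cong (_* E) (∑∈-∑-swap (shifts p m) m deviations) ⟩
      ∑ m (λ j → ∑∈ (shifts p m) (λ σ → deviations σ j)) * E
        ≡⟨ ∑-distribʳ-* m _ E ⟨
      ∑ m (λ j → ∑∈ (shifts p m) (λ σ → deviations σ j) * E)
        ≤⟨ ∑-mono m (λ j _ → ≤-trans (≤-reflexive (trans (cong (_* E) (∑∈-+ (shifts p m) (above j) (below j))) (*-distribʳ-+ E (∑∈ (shifts p m) (above j)) (∑∈ (shifts p m) (below j)))))
             (+-mono-≤ (upper-tail m d p T Q (padded x) (padded≤1 x) p+dQ≤dT j)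
                       (lower-tail m d p T Q (padded x) (padded≤1 x) p+dQ≤dT j))) ⟩
      ∑ m (λ _ → m ^ p * d ^ Q + m ^ p * d ^ Q)
        ≡⟨ ∑-const m _ ⟩
      m * (m ^ p * d ^ Q + m ^ p * d ^ Q)
        ≡⟨ regroup m (m ^ p * d ^ Q) ⟩
      (m + m) * (m ^ p * d ^ Q) ∎
      where
      open ≤-Reasoning
      E = suc d ^ Q
      regroup : ∀ m x → m * (x + x) ≡ (m + m) * x
      regroup = solve-∀

-- Naturals inside the rationals, and uniform distributions.

fromℕ≡mkℚ : ∀ m → fromℕ m ≡ mkℚ (ℤ.+ m) 0 (Coprimality.sym (1-coprimeTo m))
fromℕ≡mkℚ m = ℚ.normalize-coprime (Coprimality.sym (1-coprimeTo m))

fromℕ-+ : ∀ m n → fromℕ (m + n) ≡ fromℕ m ℚ.+ fromℕ n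
fromℕ-+ m n rewrite fromℕ≡mkℚ m | fromℕ≡mkℚ n =
  cong (ℚ._/ 1) (trans (ℤ.pos-+ m n) (sym (cong₂ ℤ._+_ (ℤ.*-identityʳ (ℤ.+ m)) (ℤ.*-identityʳ (ℤ.+ n)))))

fromℕ-* : ∀ m n → fromℕ (m * n) ≡ fromℕ m ℚ.* fromℕ n
fromℕ-* m n rewrite fromℕ≡mkℚ m | fromℕ≡mkℚ n = cong (ℚ._/ 1) (ℤ.pos-* m n)

fromℕ-^ : ∀ m k → fromℕ (m ^ k) ≡ fromℕ m ^ℚ k
fromℕ-^ m zero    = refl
fromℕ-^ m (suc k) = trans (fromℕ-* m (m ^ k)) (cong (fromℕ m ℚ.*_) (fromℕ-^ m k))

fromℕ-mono-≤ : ∀ {m n} → m ≤ n → fromℕ m ℚ.≤ fromℕ n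
fromℕ-mono-≤ {m} {n} m≤n rewrite fromℕ≡mkℚ m | fromℕ≡mkℚ n =
  ℚ.*≤* (ℤ.*-monoʳ-≤-nonNeg (ℤ.+ 1) (ℤ.+≤+ m≤n))

fromℕ-positive : ∀ m .{{_ : NonZero m}} → ℚ.Positive (fromℕ m)
fromℕ-positive m@(suc _) = subst ℚ.Positive (sym (fromℕ≡mkℚ m)) _

^ℚ-distribʳ-* : ∀ k x y → (x ℚ.* y) ^ℚ k ≡ x ^ℚ k ℚ.* y ^ℚ k
^ℚ-distribʳ-* zero    x y = refl
^ℚ-distribʳ-* (suc k) x y =
  trans (cong (x ℚ.* y ℚ.*_) (^ℚ-distribʳ-* k x y)) (ℚ*.interchange x y (x ^ℚ k) (y ^ℚ k))

u*↧u≡∣↥u∣ : ∀ u → 0ℚ ℚ.≤ u → u ℚ.* fromℕ (ℚ.↧ₙ u) ≡ fromℕ ℤ.∣ ℚ.↥ u ∣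
u*↧u≡∣↥u∣ u@(mkℚ (ℤ.+ a) b c) _ = ℚ.toℚᵘ-injective (begin
  toℚᵘ (u ℚ.* fromℕ (suc b))          ≈⟨ ℚ.toℚᵘ-homo-* u (fromℕ (suc b)) ⟩
  toℚᵘ u ℚᵘ.* toℚᵘ (fromℕ (suc b))    ≡⟨ cong (λ z → toℚᵘ u ℚᵘ.* toℚᵘ z) (fromℕ≡mkℚ (suc b)) ⟩
  toℚᵘ u ℚᵘ.* mkℚᵘ (ℤ.+ suc b) 0      ≈⟨ *≡* (trans (ℤ.*-identityʳ _) (cong (λ z → ℤ.+ a ℤ.* ℤ.+ z) (sym (*-identityʳ (suc b))))) ⟩
  mkℚᵘ (ℤ.+ a) 0                      ≡⟨ cong toℚᵘ (fromℕ≡mkℚ a) ⟨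
  toℚᵘ (fromℕ a)                      ∎)
  where open ℚᵘ.≃-Reasoning
u*↧u≡∣↥u∣ u@(mkℚ -[1+ _ ] _ _) 0≤u with ℚ.nonNegative 0≤u
... | ()

module _ {X : Set} where

  sumℚ-indicator : ∀ q (E : X → Bool) xs →
    sumℚ (map (λ (p , x) → if E x then p else 0ℚ) (map (q ,_) xs)) ≡ fromℕ (∑∈ xs (bit ∘ E)) ℚ.* q
  sumℚ-indicator q E []       = sym (ℚ.*-zeroˡ q)
  sumℚ-indicator q E (x ∷ xs) = begin
    (if E x then q else 0ℚ) ℚ.+ sumℚ (map _ (map (q ,_) xs))               ≡⟨ cong₂ ℚ._+_ (head (E x)) (sumℚ-indicator q E xs) ⟩
    fromℕ (bit (E x)) ℚ.* q ℚ.+ fromℕ (∑∈ xs (bit ∘ E)) ℚ.* q             ≡⟨ ℚ.*-distribʳ-+ q (fromℕ (bit (E x))) _ ⟨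
    (fromℕ (bit (E x)) ℚ.+ fromℕ (∑∈ xs (bit ∘ E))) ℚ.* q                 ≡⟨ cong (ℚ._* q) (fromℕ-+ (bit (E x)) _) ⟨
    fromℕ (∑∈ (x ∷ xs) (bit ∘ E)) ℚ.* q                                   ∎
    where
    open ≡-Reasoning
    head : ∀ b → (if b then q else 0ℚ) ≡ fromℕ (bit b) ℚ.* q
    head true  = sym (ℚ.*-identityˡ q)
    head false = sym (ℚ.*-zeroˡ q)

  module Uniform (xs : List X) (N : ℕ) .{{_ : NonZero N}} (∣xs∣ : ∑∈ xs (λ _ → 1) ≡ N) where

    private instance
      N-positive : ℚ.Positive (fromℕ N)
      N-positive = fromℕ-positive N
      N-nonZero : ℚ.NonZero (fromℕ N)
      N-nonZero = ℚ.pos⇒nonZero (fromℕ N)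

    q : ℚ
    q = ℚ.1/ fromℕ N

    q-nonNegative : ℚ.NonNegative q
    q-nonNegative = ℚ.pos⇒nonNeg q {{ℚ.1/pos⇒pos (fromℕ N)}}

    uniform : Distribution X
    uniform = record
      { outcomes    = map (q ,_) xs
      ; nonNegative = All.map⁺ (All.universal (λ _ → ℚ.nonNegative⁻¹ q {{q-nonNegative}}) xs)
      -- The total mass is computed as the probability of the event that always holds.
      ; total       = trans (sumℚ-indicator q (λ _ → true) xs) (trans (cong (λ z → fromℕ z ℚ.* q) ∣xs∣) (ℚ.*-inverseʳ (fromℕ N)))
      }

    Pr-uniform-≤ : ∀ E n → ∑∈ xs (bit ∘ E) * n ≤ N → Pr uniform E ℚ.* fromℕ n ℚ.≤ 1ℚ
    Pr-uniform-≤ E n le = begin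
      Pr uniform E ℚ.* fromℕ n                        ≡⟨ cong (ℚ._* fromℕ n) (sumℚ-indicator q E xs) ⟩
      fromℕ (∑∈ xs (bit ∘ E)) ℚ.* q ℚ.* fromℕ n       ≡⟨ ℚ*.xy∙z≈xz∙y (fromℕ (∑∈ xs (bit ∘ E))) q (fromℕ n) ⟩
      fromℕ (∑∈ xs (bit ∘ E)) ℚ.* fromℕ n ℚ.* q       ≡⟨ cong (ℚ._* q) (fromℕ-* (∑∈ xs (bit ∘ E)) n) ⟨
      fromℕ (∑∈ xs (bit ∘ E) * n) ℚ.* q               ≤⟨ ℚ.*-monoʳ-≤-nonNeg q {{q-nonNegative}} (fromℕ-mono-≤ le) ⟩
      fromℕ N ℚ.* q                                   ≡⟨ ℚ.*-inverseʳ (fromℕ N) ⟩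
      1ℚ                                              ∎
      where open ℚ.≤-Reasoning

-- Integer approximations of √log n and ∛n, and the size estimate.

-- Descent from a known solution until the predecessor fails. Success at `i` and failure at `j`
-- become the lower and upper estimates for `t` and for `s`.
crossing : ∀ {P : ℕ → Set} → (∀ i → Dec (P i)) → ∀ N → P N →
           ∃[ i ] P i × (i ≡ 0 ⊎ (∃[ j ] i ≡ suc j × ¬ P j))
crossing P? zero    P0 = 0 , P0 , inj₁ refl
crossing P? (suc N) PN with P? N
... | yes P′ = crossing P? N P′
... | no ¬P′ = suc N , PN , inj₂ (N , refl , ¬P′)

n≤2^n : ∀ n → n ≤ 2 ^ n
n≤2^n zero    = z≤n
n≤2^n (suc n) = ≤-trans (+-mono-≤ (m^n>0 2 n) (n≤2^n n)) (+-monoʳ-≤ (2 ^ n) (m≤m+n (2 ^ n) 0))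

^-cancelʳ-≤ : ∀ m → 1 < m → ∀ {k l} → m ^ k ≤ m ^ l → k ≤ l
^-cancelʳ-≤ m 1<m le = ≮⇒≥ λ l<k → <⇒≱ (^-monoʳ-< m 1<m l<k) le

-- From `i ≤ 2 ^ i` and `3 i ≤ 3 + i²`. It keeps `t ^ 3` of order `n`, so that a multiple of `t` can
-- approximate ∛n.
i^3≤8*2^i² : ∀ i → i ^ 3 ≤ 8 * 2 ^ (i * i)
i^3≤8*2^i² i = begin
  i ^ 3                   ≤⟨ ^-monoˡ-≤ 3 (n≤2^n i) ⟩
  (2 ^ i) ^ 3             ≡⟨ ^-*-assoc 2 i 3 ⟩
  2 ^ (i * 3)             ≤⟨ ^-monoʳ-≤ 2 (i*3≤3+i² i) ⟩
  2 ^ (3 + i * i)         ≡⟨ ^-distribˡ-+-* 2 3 (i * i) ⟩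
  8 * 2 ^ (i * i)         ∎
  where
  open ≤-Reasoning
  i*3≤3+i² : ∀ i → i * 3 ≤ 3 + i * i
  i*3≤3+i² 0 = z≤n
  i*3≤3+i² 1 = m≤m+n 3 1
  i*3≤3+i² 2 = m≤m+n 6 1
  i*3≤3+i² i@(suc (suc (suc _))) = m≤n⇒m≤o+n 3 (*-monoʳ-≤ i (s≤s (s≤s (s≤s z≤n))))

1+i≤2i : ∀ i .{{_ : NonZero i}} → suc i ≤ 2 * i
1+i≤2i i = ≤-trans (+-monoˡ-≤ i (>-nonZero⁻¹ i)) (≤-reflexive (cong (i +_) (sym (+-identityʳ i))))

-- `n ^ b ≤ 2 ^ a` says log₂ n ≤ a / b; since `i * i` is at most log₂ n, `t * t ≤ 4 * (i * i)` is at
-- most `4 a / b`.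
sqrt-log-bounds : ∀ n t i → t ≤ 2 * i → 2 ^ (i * i) ≤ n →
         (∀ a b → n ^ b ≤ 2 ^ a → t * t * b ≤ 4 * a) × t ^ 3 ≤ 64 * n
sqrt-log-bounds n t i t≤2i 2^i²≤n = below-log , cube
  where
  open ≤-Reasoning
  below-log : ∀ a b → n ^ b ≤ 2 ^ a → t * t * b ≤ 4 * a
  below-log a b n^b≤2^a = begin
    t * t * b                   ≤⟨ *-monoˡ-≤ b (*-mono-≤ t≤2i t≤2i) ⟩
    (2 * i) * (2 * i) * b       ≡⟨ regroup i b ⟩
    4 * (i * i * b)             ≤⟨ *-monoʳ-≤ 4 (^-cancelʳ-≤ 2 ≤-refl {i * i * b} {a} (begin
      2 ^ (i * i * b)     ≡⟨ ^-*-assoc 2 (i * i) b ⟨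
      (2 ^ (i * i)) ^ b   ≤⟨ ^-monoˡ-≤ b 2^i²≤n ⟩
      n ^ b               ≤⟨ n^b≤2^a ⟩
      2 ^ a               ∎)) ⟩
    4 * a                       ∎
    where
    regroup : ∀ i b → (2 * i) * (2 * i) * b ≡ 4 * (i * i * b)
    regroup = solve-∀
  cube : t ^ 3 ≤ 64 * n
  cube = begin
    t ^ 3                       ≤⟨ ^-monoˡ-≤ 3 t≤2i ⟩
    (2 * i) ^ 3                 ≡⟨ ^-distribʳ-* 3 2 i ⟩
    8 * i ^ 3                   ≤⟨ *-monoʳ-≤ 8 (≤-trans (i^3≤8*2^i² i) (*-monoʳ-≤ 8 2^i²≤n)) ⟩
    8 * (8 * n)                 ≡⟨ *-assoc 8 8 n ⟨
    64 * n                      ∎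

-- t is √(log₂ n) up to a constant factor.
sqrt-log : ∀ n → 2 ≤ n →
  ∃[ t ] NonZero t × n ≤ 2 ^ (t * t) × (∀ a b → n ^ b ≤ 2 ^ a → t * t * b ≤ 4 * a) × t ^ 3 ≤ 64 * n
sqrt-log n 2≤n with crossing (λ j → n ≤? 2 ^ (suc j * suc j)) n
                     (≤-trans (n≤2^n n) (^-monoʳ-≤ 2 (≤-trans (n≤1+n n) (m≤m*n (suc n) (suc n)))))
-- No smaller candidate has failed here; `2 ≤ n` itself supplies `2 ^ (1 * 1) ≤ n`.
... | zero  , n≤ , _ = 1 , _ , n≤ , sqrt-log-bounds n 1 1 (s≤s z≤n) 2≤n
... | suc i , n≤ , inj₂ (.i , refl , 2^i²≱n) =
  suc (suc i) , _ , n≤ , sqrt-log-bounds n (suc (suc i)) (suc i) (1+i≤2i (suc i)) (<⇒≤ (≰⇒> 2^i²≱n))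

-- s = d t is ∛n up to a constant factor.
cube-root : ∀ n t .{{_ : NonZero t}} → t ^ 3 ≤ 64 * n →
            ∃[ d ] NonZero d × n ≤ (d * t) ^ 3 × (d * t) ^ 3 ≤ 64 * n
cube-root n t t³≤64n with crossing (λ i → n ≤? (suc i * t) ^ 3) n n≤[[1+n]t]³
  where
  n≤[[1+n]t]³ : n ≤ (suc n * t) ^ 3
  n≤[[1+n]t]³ = ≤-trans (n≤1+n n) (≤-trans (m≤m*n (suc n) t) (m≤m*n (suc n * t) _ {{m^n≢0 (suc n * t) 2 {{m*n≢0 (suc n) t}}}}))
-- Here `s = t`, and the upper bound comes from the growth of `t` and not from a failed predecessor.
... | 0 , n≤ , _ = 1 , _ , n≤ , ≤-trans (≤-reflexive (cong (_^ 3) (*-identityˡ t))) t³≤64n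
... | suc i , n≤ , inj₂ (.i , refl , ≱n) = suc (suc i) , _ , n≤ , (begin
  (suc (suc i) * t) ^ 3           ≤⟨ ^-monoˡ-≤ 3 (*-monoˡ-≤ t (1+i≤2i (suc i))) ⟩
  (2 * suc i * t) ^ 3             ≡⟨ trans (cong (_^ 3) (*-assoc 2 (suc i) t)) (^-distribʳ-* 3 2 (suc i * t)) ⟩
  8 * (suc i * t) ^ 3             ≤⟨ *-mono-≤ (m≤m+n 8 56) (<⇒≤ (≰⇒> ≱n)) ⟩
  64 * n                          ∎)
  where open ≤-Reasoning

2*d^d≤[1+d]^d : ∀ d .{{_ : NonZero d}} → 2 * d ^ d ≤ suc d ^ d
2*d^d≤[1+d]^d d = *-cancelˡ-≤ d (≤-trans (≤-reflexive (regroup d (d ^ d))) (bernoulli d d))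
  where
  regroup : ∀ d x → d * (2 * x) ≡ (d + d) * x
  regroup = solve-∀

-- Since `(1 + 1/d)^d ≥ 2`, the tail factor `(1 + 1/d)^(-Q)` with `Q = d * R` is at most `2^(-R)`.
2^R*d^Q≤[1+d]^Q : ∀ d .{{_ : NonZero d}} R → 2 ^ R * d ^ (d * R) ≤ suc d ^ (d * R)
2^R*d^Q≤[1+d]^Q d R = begin
  2 ^ R * d ^ (d * R)     ≡⟨ cong (2 ^ R *_) (^-*-assoc d d R) ⟨
  2 ^ R * (d ^ d) ^ R     ≡⟨ ^-distribʳ-* R 2 (d ^ d) ⟨
  (2 * d ^ d) ^ R         ≤⟨ ^-monoˡ-≤ R (2*d^d≤[1+d]^d d) ⟩
  (suc d ^ d) ^ R         ≡⟨ ^-*-assoc (suc d) d R ⟩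
  suc d ^ (d * R)         ∎
  where open ≤-Reasoning

m≤m^3 : ∀ m → m ≤ m ^ 3
m≤m^3 zero      = z≤n
m≤m^3 m@(suc _) = m≤m*n m (m ^ 2) {{m^n≢0 m 2}}

-- With `u = a / b`, multiplying by `b³` turns the rational inequality into one between naturals.
k≤C·n^⅔·√log : ∀ k C n → (∀ a b → n ^ b ≤ 2 ^ a → k ^ 6 * b ^ 3 ≤ C ^ 6 * n ^ 4 * a ^ 3) →
                k ≤ fromℕ C ·n^⅔·√log n
k≤C·n^⅔·√log k C n bound u (0≤u , n^b≤2^a) = ℚ.*-cancelʳ-≤-pos (fromℕ b ^ℚ 3) {{positive}} $ begin
  fromℕ k ^ℚ 6 ℚ.* fromℕ b ^ℚ 3                                     ≡⟨ cong₂ ℚ._*_ (fromℕ-^ k 6) (fromℕ-^ b 3) ⟨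
  fromℕ (k ^ 6) ℚ.* fromℕ (b ^ 3)                                   ≡⟨ fromℕ-* (k ^ 6) (b ^ 3) ⟨
  fromℕ (k ^ 6 * b ^ 3)                                             ≤⟨ fromℕ-mono-≤ (bound a b n^b≤2^a) ⟩
  fromℕ (C ^ 6 * n ^ 4 * a ^ 3)                                     ≡⟨ trans (fromℕ-* (C ^ 6 * n ^ 4) (a ^ 3)) (cong₂ ℚ._*_ (fromℕ-* (C ^ 6) (n ^ 4)) (fromℕ-^ a 3)) ⟩
  fromℕ (C ^ 6) ℚ.* fromℕ (n ^ 4) ℚ.* fromℕ a ^ℚ 3                  ≡⟨ cong₂ ℚ._*_ (cong₂ ℚ._*_ (fromℕ-^ C 6) (fromℕ-^ n 4)) (cong (_^ℚ 3) (sym (u*↧u≡∣↥u∣ u 0≤u))) ⟩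
  fromℕ C ^ℚ 6 ℚ.* fromℕ n ^ℚ 4 ℚ.* (u ℚ.* fromℕ b) ^ℚ 3            ≡⟨ cong (fromℕ C ^ℚ 6 ℚ.* fromℕ n ^ℚ 4 ℚ.*_) (^ℚ-distribʳ-* 3 u (fromℕ b)) ⟩
  fromℕ C ^ℚ 6 ℚ.* fromℕ n ^ℚ 4 ℚ.* (u ^ℚ 3 ℚ.* fromℕ b ^ℚ 3)       ≡⟨ ℚ.*-assoc (fromℕ C ^ℚ 6 ℚ.* fromℕ n ^ℚ 4) (u ^ℚ 3) (fromℕ b ^ℚ 3) ⟨
  fromℕ C ^ℚ 6 ℚ.* fromℕ n ^ℚ 4 ℚ.* u ^ℚ 3 ℚ.* fromℕ b ^ℚ 3         ∎
  where
  open ℚ.≤-Reasoning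
  a = ℤ.∣ ℚ.↥ u ∣
  b = ℚ.↧ₙ u
  positive : ℚ.Positive (fromℕ b ^ℚ 3)
  positive = subst ℚ.Positive (fromℕ-^ b 3) (fromℕ-positive (b ^ 3) {{m^n≢0 b 3}})

-- The sixth power makes the exponents integral: `(s² t)⁶ b³ = (s³)⁴ (t² b)³`, and each hypothesis
-- bounds one factor.
size-bound : ∀ c₁ c₂ c₃ s t n a b → s ^ 3 ≤ c₂ * n → t * t * b ≤ c₃ * a →
             (c₁ * (s * s * t)) ^ 6 * b ^ 3 ≤ c₁ ^ 6 * (c₂ ^ 4 * c₃ ^ 3) * n ^ 4 * a ^ 3
size-bound c₁ c₂ c₃ s t n a b s³≤ t²b≤ = begin
  (c₁ * (s * s * t)) ^ 6 * b ^ 3                        ≡⟨ cong (_* b ^ 3) (^-distribʳ-* 6 c₁ (s * s * t)) ⟩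
  c₁ ^ 6 * (s * s * t) ^ 6 * b ^ 3                      ≡⟨ trans (*-assoc (c₁ ^ 6) _ (b ^ 3)) (cong (c₁ ^ 6 *_) cubes) ⟩
  c₁ ^ 6 * ((s ^ 3) ^ 4 * (t * t * b) ^ 3)              ≤⟨ *-monoʳ-≤ (c₁ ^ 6) (*-mono-≤ (^-monoˡ-≤ 4 s³≤) (^-monoˡ-≤ 3 t²b≤)) ⟩
  c₁ ^ 6 * ((c₂ * n) ^ 4 * (c₃ * a) ^ 3)                ≡⟨ cong (c₁ ^ 6 *_) (cong₂ _*_ (^-distribʳ-* 4 c₂ n) (^-distribʳ-* 3 c₃ a)) ⟩
  c₁ ^ 6 * (c₂ ^ 4 * n ^ 4 * (c₃ ^ 3 * a ^ 3))          ≡⟨ regroup (c₁ ^ 6) (c₂ ^ 4) (c₃ ^ 3) (n ^ 4) (a ^ 3) ⟩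
  c₁ ^ 6 * (c₂ ^ 4 * c₃ ^ 3) * n ^ 4 * a ^ 3            ∎
  where
  open ≤-Reasoning
  regroup : ∀ α β γ x y → α * (β * x * (γ * y)) ≡ α * (β * γ) * x * y
  regroup = solve-∀
  square : ∀ s t b → s * s * t * (s * s * t * 1) * b ≡ s * (s * (s * (s * 1))) * (t * t * b)
  square = solve-∀
  cubes : (s * s * t) ^ 6 * b ^ 3 ≡ (s ^ 3) ^ 4 * (t * t * b) ^ 3
  cubes = begin-equality
    (s * s * t) ^ 6 * b ^ 3             ≡⟨ cong (_* b ^ 3) (^-*-assoc (s * s * t) 2 3) ⟨
    ((s * s * t) ^ 2) ^ 3 * b ^ 3       ≡⟨ ^-distribʳ-* 3 ((s * s * t) ^ 2) b ⟨
    ((s * s * t) ^ 2 * b) ^ 3           ≡⟨ cong (_^ 3) (square s t b) ⟩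
    (s ^ 4 * (t * t * b)) ^ 3           ≡⟨ ^-distribʳ-* 3 (s ^ 4) (t * t * b) ⟩
    (s ^ 4) ^ 3 * (t * t * b) ^ 3       ≡⟨ cong (_* (t * t * b) ^ 3) (trans (^-*-assoc s 4 3) (sym (^-*-assoc s 3 4))) ⟩
    (s ^ 3) ^ 4 * (t * t * b) ^ 3       ∎

-- The choice of parameters and the resulting randomized circuit.

module Parameters (n : ℕ) (2≤n : 2 ≤ n) (t d : ℕ) .{{_ : NonZero t}} .{{_ : NonZero d}}
                  (n≤2^t² : n ≤ 2 ^ (t * t)) (n≤s³ : n ≤ (d * t) ^ 3) (s³≤64n : (d * t) ^ 3 ≤ 64 * n)
                  (t²≤4log : ∀ a b → n ^ b ≤ 2 ^ a → t * t * b ≤ 4 * a) where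

  s p T R Q k : ℕ
  s = d * t
  p = s * s
  -- Of the ten parts `d t²`, one is the excess `p / d` and nine form `Q`. Nine suffice because
  -- `(s + s) * n ≤ 128 n² ≤ n⁹`, where `s + s` counts the tails and `n` is the target for the
  -- error.
  T = d * (10 * (t * t))
  R = 9 * (t * t)
  Q = d * R
  k = s * (4 * T)

  instance
    s≢0 : NonZero s
    s≢0 = m*n≢0 d t
    T≢0 : NonZero T
    T≢0 = m*n≢0 d (10 * (t * t)) {{it}} {{m*n≢0 10 (t * t) {{_}} {{m*n≢0 t t}}}}

  k≡ : k ≡ 40 * (s * s * t)
  k≡ = regroup d t
    where
    regroup : ∀ d t → d * t * (4 * (d * (10 * (t * t)))) ≡ 40 * (d * t * (d * t) * t)
    regroup = solve-∀

  p≤k : p ≤ k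
  p≤k = begin
    s * s               ≤⟨ m≤m*n (s * s) t ⟩
    s * s * t           ≤⟨ m≤n*m (s * s * t) 40 ⟩
    40 * (s * s * t)    ≡⟨ k≡ ⟨
    k                   ∎
    where open ≤-Reasoning

  0<k : 0 < k
  0<k = ≤-trans (>-nonZero⁻¹ (s * s) {{m*n≢0 s s}}) p≤k

  n≤ps : n ≤ p * s
  n≤ps = ≤-trans n≤s³ (≤-reflexive (regroup s))
    where
    regroup : ∀ s → s * (s * (s * 1)) ≡ s * s * s
    regroup = solve-∀

  p+dQ≤dT : p + d * Q ≤ d * T
  p+dQ≤dT = ≤-reflexive (regroup d t)
    where
    regroup : ∀ d t → d * t * (d * t) + d * (d * (9 * (t * t))) ≡ d * (d * (10 * (t * t)))
    regroup = solve-∀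

  2sn≤2^R : (s + s) * n ≤ 2 ^ R
  2sn≤2^R = begin
    (s + s) * n               ≤⟨ *-monoˡ-≤ n (+-mono-≤ s≤ s≤) ⟩
    (64 * n + 64 * n) * n     ≡⟨ regroup n ⟩
    2 ^ 7 * (n * n)           ≤⟨ *-monoˡ-≤ (n * n) (^-monoˡ-≤ 7 2≤n) ⟩
    n ^ 7 * (n * n)           ≡⟨ trans (cong (λ z → n ^ 7 * (n * z)) (sym (*-identityʳ n))) (sym (^-distribˡ-+-* n 7 2)) ⟩
    n ^ 9                     ≤⟨ ^-monoˡ-≤ 9 n≤2^t² ⟩
    (2 ^ (t * t)) ^ 9         ≡⟨ trans (^-*-assoc 2 (t * t) 9) (cong (2 ^_) (*-comm (t * t) 9)) ⟩
    2 ^ R                     ∎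
    where
    open ≤-Reasoning
    s≤ : s ≤ 64 * n
    s≤ = ≤-trans (m≤m^3 s) s³≤64n
    regroup : ∀ n → (64 * n + 64 * n) * n ≡ 128 * (n * n)
    regroup = solve-∀

  open Construction n s p T k p≤k ≤-refl n≤ps using (circuit; errors; errors-bound)

  errors*n≤ : ∀ x → errors x * n ≤ s ^ p
  errors*n≤ x = *-cancelˡ-≤ (s + s) {{>-nonZero (≤-trans (>-nonZero⁻¹ s) (m≤m+n s s))}} $
                *-cancelʳ-≤ _ _ (d ^ Q) {{m^n≢0 d Q}} $ begin
    (s + s) * (errors x * n) * d ^ Q      ≡⟨ regroup (s + s) (errors x) n (d ^ Q) ⟩
    errors x * ((s + s) * n * d ^ Q)      ≤⟨ *-monoʳ-≤ (errors x) (*-monoˡ-≤ (d ^ Q) 2sn≤2^R) ⟩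
    errors x * (2 ^ R * d ^ Q)            ≤⟨ *-monoʳ-≤ (errors x) (2^R*d^Q≤[1+d]^Q d R) ⟩
    errors x * suc d ^ Q                  ≤⟨ errors-bound x d Q p+dQ≤dT ⟩
    (s + s) * (s ^ p * d ^ Q)             ≡⟨ *-assoc (s + s) (s ^ p) (d ^ Q) ⟨
    (s + s) * s ^ p * d ^ Q               ∎
    where
    open ≤-Reasoning
    regroup : ∀ a b c z → a * (b * c) * z ≡ b * (a * c * z)
    regroup = solve-∀

  k-bound : ∀ a b → n ^ b ≤ 2 ^ a → k ^ 6 * b ^ 3 ≤ 1280 ^ 6 * n ^ 4 * a ^ 3
  k-bound a b n^b≤2^a =
    subst₂ (λ k c → k ^ 6 * b ^ 3 ≤ c * n ^ 4 * a ^ 3) (sym k≡) constants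
      (size-bound 40 64 4 s t n a b s³≤64n (t²≤4log a b n^b≤2^a))
    where
    -- `64⁴ · 4³ = 2³⁰ = 32⁶`, hence the constant `1280 = 40 · 32`.
    constants : 40 ^ 6 * (64 ^ 4 * 4 ^ 3) ≡ 1280 ^ 6
    constants = refl

  open Uniform (map circuit (shifts p s)) (s ^ p) {{m^n≢0 s p}}
               (trans (∑∈-map circuit (shifts p s) (λ _ → 1)) (∑∈-shifts-1 p s))

  error≤1/n : (A : Vec Bool n) → error uniform A ≤ n ^- 1ℚ
  error≤1/n A =
    subst (ℚ._≤ 1ℚ) (sym (cong₂ ℚ._*_ (ℚ.*-identityʳ (error uniform A)) (ℚ.*-identityʳ (fromℕ n))))
      (Pr-uniform-≤ _ n (subst (λ z → z * n ≤ s ^ p) (sym (∑∈-map circuit (shifts p s) _)) (errors*n≤ A)))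

  randomizedCircuit : ∃[ k ] (0 < k) × (k ≤ fromℕ 1280 ·n^⅔·√log n) ×
                      (Σ[ 𝒞 ∈ RandomizedCircuit k n ] ((A : Vec Bool n) → error 𝒞 A ≤ n ^- 1ℚ))
  randomizedCircuit = k , 0<k , k≤C·n^⅔·√log k 1280 n k-bound , uniform , error≤1/n

theorem9 : ∃[ c ] ∃[ C ] (0ℚ <ℚ c) × (0ℚ <ℚ C) ×
    ((n : ℕ) → 2 ≤ n →
    ∃[ k ] (0 < k) × (k ≤ C ·n^⅔·√log n) ×
    (Σ[ 𝒞 ∈ RandomizedCircuit k n ]
    ((A : Vec Bool n) → error 𝒞 A ≤ n ^- c)))
theorem9 = 1ℚ , fromℕ 1280 , ℚ.positive⁻¹ 1ℚ , ℚ.positive⁻¹ (fromℕ 1280) {{fromℕ-positive 1280}} , circuits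
  where
  circuits : (n : ℕ) → 2 ≤ n →
             ∃[ k ] (0 < k) × (k ≤ fromℕ 1280 ·n^⅔·√log n) ×
             (Σ[ 𝒞 ∈ RandomizedCircuit k n ] ((A : Vec Bool n) → error 𝒞 A ≤ n ^- 1ℚ))
  circuits n 2≤n =
    let t , t≢0 , n≤2^t² , t²≤4log , t³≤64n = sqrt-log n 2≤n
        d , d≢0 , n≤s³ , s³≤64n             = cube-root n t {{t≢0}} t³≤64n
    in Parameters.randomizedCircuit n 2≤n t d {{t≢0}} {{d≢0}} n≤2^t² n≤s³ s³≤64n t²≤4log
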